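{- A natural model is the same thing as a plain dependent type theory in which the type fibration $u$ and the term fibration $\dot u$ are discrete fibrations.
   Context: Natural model: a category $\mathbf{ctx}$ with terminal object, a morphism $p:\dot U\to U$ in the category of presheaves of sets on $\mathbf{ctx}$, and representability data: for every object $\Gamma$ of $\mathbf{ctx}$ and every morphism $A:y\Gamma\to U$ (with $y$ the Yoneda embedding; equivalently, every $A\in U(\Gamma)$) there are given an object $\Gamma.A$ of $\mathbf{ctx}$, a morphism $\delta_A:\Gamma.A\to\Gamma$ in $\mathbf{ctx}$ and a morphism $q_A:y(\Gamma.A)\to\dot U$ such that the square with top $q_A$, left side $y(\delta_A)$, bottom $A$ and right side $p$ is a pullback. Pre-judgemental theory: a category $\mathbf{ctx}$ (with terminal object), a set $\mathscr J$ of functors with codomain $\mathbf{ctx}$ ("judgement classifiers"), a set $\mathscr R$ of functors ("rules"), and a set $\mathscr P$ of natural transformations ("policies") filling some triangles formed by rules and judgement classifiers. It is a judgemental theory if $\mathscr R$ and $\mathscr P$ are closed under composition, the judgement classifiers are precisely the rules with codomain $\mathbf{ctx}$, and $\mathscr R,\mathscr P$ are closed under finite limits (pullbacks, equalizers, finite powers, with their projections and the functors induced by cones of rules), whiskering, and $\sharp$-liftings. Closure under $\sharp$-liftings means: given rules $\lambda:\mathcal F\to\mathcal G$, $r:\mathcal F\to\mathcal X$, $r':\mathcal G\to\mathcal X$, a policy $\lambda^\sharp:r'\lambda\Rightarrow r$ and a rule $h:\mathcal H\to\mathcal X$ that is a fibration, the functor $\mathcal F\times_{\mathcal X}\mathcal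 H\to\mathcal G\times_{\mathcal X}\mathcal H$, $(F,H)\mapsto(\lambda F,H[\lambda^\sharp_F])$ (reindexing along $\lambda^\sharp_F$) is a rule and the natural transformation whose components are the cartesian lifts $H[\lambda^\sharp_F]\to H$ is a policy; and dually for opfibrations. The judgemental theory generated by a pre-judgemental theory is the smallest one containing it. A (pre-)judgemental theory is substitutional if its judgement classifiers are fibrations, its rules preserve cartesian morphisms, and its policies have cartesian components. Plain dependent type theory: a substitutional judgemental theory generated by a pre-judgemental theory of the following form. $\mathscr J=\{u,\dot u\}$, where $u:\mathcal U\to\mathbf{ctx}$ (types) and $\dot u:\dot{\mathcal U}\to\mathbf{ctx}$ (terms) are fibrations; $\mathscr R=\{\Sigma,\Delta\}$, where $\Sigma:\dot{\mathcal U}\to\mathcal U$ satisfies $u\Sigma=\dot u$ and $\Delta:\mathcal U\to\dot{\mathcal U}$ is a right adjoint of $\Sigma$ (not required to commute with the functors to $\mathbf{ctx}$); $\mathscr P$ contains the witness of the commutativity $u\Sigma=\dot u$ and the unit $\eta$ and counit $\epsilon$ of $\Sigma\dashv\Delta$; and $\eta$ and $\epsilon$ are required to have cartesian components.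
   Formalization: Substitutionality is required only of the generating pre-judgemental theory, not of the whole generated judgemental theory, where the claim fails: for finite sets with U = 1 and Γ.A = Γ×2, the classifier u̇Δ = (–×2) is not a fibration. -}

module Defs where

open import Level using (Level; suc; _⊔_)
open import Data.Nat.Base using (ℕ)
open import Data.Fin.Base using (Fin)
open import Data.Product.Base using (Σ; Σ-syntax; ∃-syntax; _×_; _,_; proj₁; proj₂)
open import Data.Product using (∃!)
open import Function.Base using (_∘′_)
open import Relation.Binary.Structures using (IsEquivalence)
open import Relation.Binary.PropositionalEquality
  using (_≡_; refl; sym; trans; cong; cong₂; subst)

private
  variable
    o o′ e h h′ e′ ℓ : Level

-- Two notions of category are used.  `Category ℓ` is a small category in the
-- strict sense: objects and morphisms form sets (axiom K is available), equality
-- of objects is meaningful, and so discrete fibrations can be spoken of.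
-- `ECategory` has a setoid of morphisms; it is used for the large categories whose
-- morphisms are (families of) functions or functors, as there is no function
-- extensionality.

record ECategory (o h e : Level) : Set (suc (o ⊔ h ⊔ e)) where
  infix  4 _≈_ _⇒_
  infixr 9 _∘_
  field
    Obj       : Set o
    _⇒_       : Obj → Obj → Set h
    _≈_       : ∀ {A B} → A ⇒ B → A ⇒ B → Set e
    id        : ∀ {A} → A ⇒ A
    _∘_       : ∀ {A B C} → B ⇒ C → A ⇒ B → A ⇒ C
    assoc     : ∀ {A B C D} (k : C ⇒ D) (g : B ⇒ C) (f : A ⇒ B) →
                (k ∘ g) ∘ f ≈ k ∘ (g ∘ f)
    identityˡ : ∀ {A B} (f : A ⇒ B) → id ∘ f ≈ f
    identityʳ : ∀ {A B} (f : A ⇒ B) → f ∘ id ≈ f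
    equiv     : ∀ {A B} → IsEquivalence (_≈_ {A} {B})
    ∘-resp-≈  : ∀ {A B C} {g g′ : B ⇒ C} {f f′ : A ⇒ B} →
                g ≈ g′ → f ≈ f′ → g ∘ f ≈ g′ ∘ f′

module _ (𝒞 : ECategory o h e) where
  open ECategory 𝒞

  record IsPullback {P A B C} (p₁ : P ⇒ A) (p₂ : P ⇒ B) (f : A ⇒ C) (g : B ⇒ C)
         : Set (o ⊔ h ⊔ e) where
    field
      commute   : f ∘ p₁ ≈ g ∘ p₂
      universal : ∀ {Q} (a : Q ⇒ A) (b : Q ⇒ B) → f ∘ a ≈ g ∘ b →
                  ∃! _≈_ λ (m : Q ⇒ P) → p₁ ∘ m ≈ a × p₂ ∘ m ≈ b

  record IsEqualizer {E A B} (i : E ⇒ A) (f g : A ⇒ B) : Set (o ⊔ h ⊔ e) where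
    field
      equalize  : f ∘ i ≈ g ∘ i
      universal : ∀ {Q} (a : Q ⇒ A) → f ∘ a ≈ g ∘ a →
                  ∃! _≈_ λ (m : Q ⇒ E) → i ∘ m ≈ a

  IsPower : ∀ {n P A} → (Fin n → P ⇒ A) → Set (o ⊔ h ⊔ e)
  IsPower {n} {P} {A} π = ∀ {Q} (a : Fin n → Q ⇒ A) →
                          ∃! _≈_ λ (m : Q ⇒ P) → ∀ i → π i ∘ m ≈ a i

  record Iso (A B : Obj) : Set (h ⊔ e) where
    field
      to      : A ⇒ B
      from    : B ⇒ A
      from∘to : from ∘ to ≈ id
      to∘from : to ∘ from ≈ id

record EFunctor (𝒞 : ECategory o h e) (𝒟 : ECategory o′ h′ e′)
       : Set (o ⊔ h ⊔ e ⊔ o′ ⊔ h′ ⊔ e′) where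
  private
    module 𝒞 = ECategory 𝒞
    module 𝒟 = ECategory 𝒟
  field
    F₀       : 𝒞.Obj → 𝒟.Obj
    F₁       : ∀ {A B} → A 𝒞.⇒ B → F₀ A 𝒟.⇒ F₀ B
    F-resp-≈ : ∀ {A B} {f g : A 𝒞.⇒ B} → f 𝒞.≈ g → F₁ f 𝒟.≈ F₁ g
    F-id     : ∀ {A} → F₁ (𝒞.id {A}) 𝒟.≈ 𝒟.id
    F-∘      : ∀ {A B C} (g : B 𝒞.⇒ C) (f : A 𝒞.⇒ B) →
               F₁ (g 𝒞.∘ f) 𝒟.≈ F₁ g 𝒟.∘ F₁ f

record Equivalence (𝒞 : ECategory o h e) (𝒟 : ECategory o′ h′ e′)
       : Set (o ⊔ h ⊔ e ⊔ o′ ⊔ h′ ⊔ e′) where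
  private
    module 𝒞 = ECategory 𝒞
    module 𝒟 = ECategory 𝒟
  field
    to   : EFunctor 𝒞 𝒟
    from : EFunctor 𝒟 𝒞
  private
    module T = EFunctor to
    module F = EFunctor from
  field
    unit           : ∀ X → Iso 𝒞 X (F.F₀ (T.F₀ X))
    unit-natural   : ∀ {X Y} (f : X 𝒞.⇒ Y) →
                     Iso.to (unit Y) 𝒞.∘ f 𝒞.≈ F.F₁ (T.F₁ f) 𝒞.∘ Iso.to (unit X)
    counit         : ∀ X → Iso 𝒟 (T.F₀ (F.F₀ X)) X
    counit-natural : ∀ {X Y} (f : X 𝒟.⇒ Y) →
                     Iso.to (counit Y) 𝒟.∘ T.F₁ (F.F₁ f) 𝒟.≈ f 𝒟.∘ Iso.to (counit X)

record Category (ℓ : Level) : Set (suc ℓ) where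
  infix  4 _⇒_
  infixr 9 _∘_
  field
    Obj       : Set ℓ
    _⇒_       : Obj → Obj → Set ℓ
    id        : ∀ {A} → A ⇒ A
    _∘_       : ∀ {A B C} → B ⇒ C → A ⇒ B → A ⇒ C
    assoc     : ∀ {A B C D} (k : C ⇒ D) (g : B ⇒ C) (f : A ⇒ B) →
                (k ∘ g) ∘ f ≡ k ∘ (g ∘ f)
    identityˡ : ∀ {A B} (f : A ⇒ B) → id ∘ f ≡ f
    identityʳ : ∀ {A B} (f : A ⇒ B) → f ∘ id ≡ f

infix 10 _[_,_] _[_∘_]

_[_,_] : (𝒞 : Category ℓ) → Category.Obj 𝒞 → Category.Obj 𝒞 → Set ℓ
_[_,_] = Category._⇒_

_[_∘_] : (𝒞 : Category ℓ) → ∀ {A B C} → 𝒞 [ B , C ] → 𝒞 [ A , B ] → 𝒞 [ A , C ]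
_[_∘_] = Category._∘_

record Terminal (𝒞 : Category ℓ) : Set ℓ where
  open Category 𝒞
  field
    ⊤        : Obj
    !        : ∀ {A} → A ⇒ ⊤
    !-unique : ∀ {A} (f : A ⇒ ⊤) → ! ≡ f

op : Category ℓ → Category ℓ
op 𝒞 = record
  { Obj       = Obj
  ; _⇒_       = λ A B → B ⇒ A
  ; id        = id
  ; _∘_       = λ g f → f ∘ g
  ; assoc     = λ k g f → sym (assoc f g k)
  ; identityˡ = identityʳ
  ; identityʳ = identityˡ
  }
  where open Category 𝒞

-- An equation  arrow f ≡ arrow g  between morphisms whose (co)domains need not
-- coincide definitionally says that the domains, the codomains and the morphisms
-- are equal.

Arrow : Category ℓ → Set ℓ
Arrow 𝒞 = Σ[ A ∈ Category.Obj 𝒞 ] Σ[ B ∈ Category.Obj 𝒞 ] 𝒞 [ A , B ]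

arrow : (𝒞 : Category ℓ) → ∀ {A B} → 𝒞 [ A , B ] → Arrow 𝒞
arrow 𝒞 {A} {B} f = A , B , f

record Functor (𝒞 𝒟 : Category ℓ) : Set ℓ where
  private
    module 𝒞 = Category 𝒞
    module 𝒟 = Category 𝒟
  field
    F₀   : 𝒞.Obj → 𝒟.Obj
    F₁   : ∀ {A B} → 𝒞 [ A , B ] → 𝒟 [ F₀ A , F₀ B ]
    F-id : ∀ {A} → F₁ (𝒞.id {A}) ≡ 𝒟.id
    F-∘  : ∀ {A B C} (g : 𝒞 [ B , C ]) (f : 𝒞 [ A , B ]) →
           F₁ (𝒞 [ g ∘ f ]) ≡ 𝒟 [ F₁ g ∘ F₁ f ]

  onArrow : Arrow 𝒞 → Arrow 𝒟
  onArrow (A , B , f) = F₀ A , F₀ B , F₁ f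

open Functor public using () renaming (F₀ to infixl 20 _₀_; F₁ to infixl 20 _₁_)

idF : (𝒞 : Category ℓ) → Functor 𝒞 𝒞
idF 𝒞 = record { F₀ = λ A → A ; F₁ = λ f → f ; F-id = refl ; F-∘ = λ _ _ → refl }

infixr 9 _∘F_

_∘F_ : {𝒞 𝒟 ℰ : Category ℓ} → Functor 𝒟 ℰ → Functor 𝒞 𝒟 → Functor 𝒞 ℰ
G ∘F F = record
  { F₀   = λ A → G ₀ (F ₀ A)
  ; F₁   = λ f → G ₁ (F ₁ f)
  ; F-id = trans (cong (G ₁_) F.F-id) G.F-id
  ; F-∘  = λ g f → trans (cong (G ₁_) (F.F-∘ g f)) (G.F-∘ (F ₁ g) (F ₁ f))
  }
  where
  module F = Functor F
  module G = Functor G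

opF : {𝒞 𝒟 : Category ℓ} → Functor 𝒞 𝒟 → Functor (op 𝒞) (op 𝒟)
opF F = record
  { F₀ = F ₀_ ; F₁ = F ₁_ ; F-id = Functor.F-id F ; F-∘ = λ g f → Functor.F-∘ F f g }

-- Strict equality of functors; agreement on objects is the case of identities.

infix 4 _≡ᶠ_

record _≡ᶠ_ {𝒞 𝒟 : Category ℓ} (F G : Functor 𝒞 𝒟) : Set ℓ where
  constructor mk≡ᶠ
  field
    on-arrow : ∀ {A B} (f : 𝒞 [ A , B ]) → arrow 𝒟 (F ₁ f) ≡ arrow 𝒟 (G ₁ f)

  on-obj : ∀ A → F ₀ A ≡ G ₀ A
  on-obj A = cong proj₁ (on-arrow (Category.id 𝒞 {A}))

open _≡ᶠ_ public

≡ᶠ-refl : {𝒞 𝒟 : Category ℓ} {F : Functor 𝒞 𝒟} → F ≡ᶠ F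
≡ᶠ-refl = mk≡ᶠ λ _ → refl

≡ᶠ-trans : {𝒞 𝒟 : Category ℓ} {F G H : Functor 𝒞 𝒟} → F ≡ᶠ G → G ≡ᶠ H → F ≡ᶠ H
≡ᶠ-trans p q = mk≡ᶠ λ f → trans (on-arrow p f) (on-arrow q f)

≡ᶠ-sym : {𝒞 𝒟 : Category ℓ} {F G : Functor 𝒞 𝒟} → F ≡ᶠ G → G ≡ᶠ F
≡ᶠ-sym p = mk≡ᶠ λ f → sym (on-arrow p f)

≡ᶠ-isEquivalence : {𝒞 𝒟 : Category ℓ} → IsEquivalence (_≡ᶠ_ {𝒞 = 𝒞} {𝒟})
≡ᶠ-isEquivalence = record
  { refl = ≡ᶠ-refl ; sym = ≡ᶠ-sym ; trans = ≡ᶠ-trans }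

∘F-resp-≡ᶠ : {𝒞 𝒟 ℰ : Category ℓ} {G G′ : Functor 𝒟 ℰ} {F F′ : Functor 𝒞 𝒟} →
            G ≡ᶠ G′ → F ≡ᶠ F′ → G ∘F F ≡ᶠ G′ ∘F F′
∘F-resp-≡ᶠ {G′ = G′} {F = F} p q =
  mk≡ᶠ λ f → trans (on-arrow p (F ₁ f)) (cong (Functor.onArrow G′) (on-arrow q f))

Cat : (ℓ : Level) → ECategory (suc ℓ) ℓ ℓ
Cat ℓ = record
  { Obj       = Category ℓ
  ; _⇒_       = Functor
  ; _≈_       = _≡ᶠ_
  ; id        = idF _
  ; _∘_       = _∘F_
  ; assoc     = λ _ _ _ → mk≡ᶠ λ _ → refl
  ; identityˡ = λ _ → mk≡ᶠ λ _ → refl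
  ; identityʳ = λ _ → mk≡ᶠ λ _ → refl
  ; equiv     = ≡ᶠ-isEquivalence
  ; ∘-resp-≈  = ∘F-resp-≡ᶠ
  }

record NatTrans {𝒞 𝒟 : Category ℓ} (F G : Functor 𝒞 𝒟) : Set ℓ where
  field
    at      : ∀ A → 𝒟 [ F ₀ A , G ₀ A ]
    natural : ∀ {A B} (f : 𝒞 [ A , B ]) → 𝒟 [ at B ∘ F ₁ f ] ≡ 𝒟 [ G ₁ f ∘ at A ]

open NatTrans public using (at)

infixr 9 _∘ˡ_ _∘ʳ_ _•_

_•_ : {𝒞 𝒟 : Category ℓ} {F G H : Functor 𝒞 𝒟} →
      NatTrans G H → NatTrans F G → NatTrans F H
_•_ {𝒟 = 𝒟} {F} {G} {H} β α = record
  { at      = λ A → at β A ∘ at α A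
  ; natural = λ {A} {B} f →
      trans (assoc (at β B) (at α B) (F ₁ f))
     (trans (cong (at β B ∘_) (NatTrans.natural α f))
     (trans (sym (assoc (at β B) (G ₁ f) (at α A)))
     (trans (cong (_∘ at α A) (NatTrans.natural β f))
            (assoc (H ₁ f) (at β A) (at α A)))))
  }
  where open Category 𝒟

_∘ˡ_ : {𝒞 𝒟 ℰ : Category ℓ} {F G : Functor 𝒞 𝒟} (H : Functor 𝒟 ℰ) →
       NatTrans F G → NatTrans (H ∘F F) (H ∘F G)
_∘ˡ_ {F = F} {G} H α = record
  { at      = λ A → H ₁ at α A
  ; natural = λ {A} {B} f →
      trans (sym (Functor.F-∘ H (at α B) (F ₁ f)))
     (trans (cong (H ₁_) (NatTrans.natural α f))
            (Functor.F-∘ H (G ₁ f) (at α A)))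
  }

_∘ʳ_ : {ℬ 𝒞 𝒟 : Category ℓ} {F G : Functor 𝒞 𝒟} →
       NatTrans F G → (K : Functor ℬ 𝒞) → NatTrans (F ∘F K) (G ∘F K)
α ∘ʳ K = record { at = λ A → at α (K ₀ A) ; natural = λ f → NatTrans.natural α (K ₁ f) }

infix 4 _≋_

record _≋_ {𝒞 𝒟 : Category ℓ} {F G F′ G′ : Functor 𝒞 𝒟}
           (α : NatTrans F G) (β : NatTrans F′ G′) : Set ℓ where
  field
    source     : F ≡ᶠ F′
    target     : G ≡ᶠ G′
    components : ∀ A → arrow 𝒟 (at α A) ≡ arrow 𝒟 (at β A)

-- The transformation with identity components between strictly equal functors.

module _ {𝒞 𝒟 : Category ℓ} {F G : Functor 𝒞 𝒟} (F≡G : F ≡ᶠ G) where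
  open Category 𝒟

  private
    idAlong : ∀ {A B} → A ≡ B → A ⇒ B
    idAlong p = subst (_ ⇒_) p id

    square : ∀ {A B A′ B′} {f : A ⇒ B} {f′ : A′ ⇒ B′} (p : A ≡ A′) (q : B ≡ B′) →
             arrow 𝒟 f ≡ arrow 𝒟 f′ → idAlong q ∘ f ≡ f′ ∘ idAlong p
    square {f = f} refl refl refl = trans (identityˡ f) (sym (identityʳ f))

  identityTransformation : NatTrans F G
  identityTransformation = record
    { at      = λ A → idAlong (on-obj F≡G A)
    ; natural = λ {A} {B} f → square (on-obj F≡G A) (on-obj F≡G B) (on-arrow F≡G f)
    }

infix 4 _⊣_

record _⊣_ {𝒞 𝒟 : Category ℓ} (L : Functor 𝒞 𝒟) (R : Functor 𝒟 𝒞) : Set ℓ where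
  field
    η   : NatTrans (idF 𝒞) (R ∘F L)
    ε   : NatTrans (L ∘F R) (idF 𝒟)
    zig : ∀ A → 𝒟 [ at ε (L ₀ A) ∘ L ₁ at η A ] ≡ Category.id 𝒟
    zag : ∀ B → 𝒞 [ R ₁ at ε B ∘ at η (R ₀ B) ] ≡ Category.id 𝒞

module _ {ℰ ℬ : Category ℓ} (p : Functor ℰ ℬ) where
  private
    module ℰ = Category ℰ
    module ℬ = Category ℬ

  IsCartesian : ∀ {A B} → ℰ [ A , B ] → Set ℓ
  IsCartesian {A} {B} f =
    ∀ {Z} (g : ℰ [ Z , B ]) (w : ℬ [ p ₀ Z , p ₀ A ]) → ℬ [ p ₁ f ∘ w ] ≡ p ₁ g →
    ∃! _≡_ λ (k : ℰ [ Z , A ]) → p ₁ k ≡ w × ℰ [ f ∘ k ] ≡ g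

  record IsFibration : Set ℓ where
    field
      reindex   : ∀ E {I} → ℬ [ I , p ₀ E ] → ℰ.Obj
      lift      : ∀ E {I} (σ : ℬ [ I , p ₀ E ]) → ℰ [ reindex E σ , E ]
      over      : ∀ E {I} (σ : ℬ [ I , p ₀ E ]) → arrow ℬ (p ₁ lift E σ) ≡ arrow ℬ σ
      cartesian : ∀ E {I} (σ : ℬ [ I , p ₀ E ]) → IsCartesian (lift E σ)

  IsDiscreteFibration : Set ℓ
  IsDiscreteFibration =
    ∀ E {I} (σ : ℬ [ I , p ₀ E ]) →
    ∃! _≡_ λ ((E′ , f) : Σ[ E′ ∈ ℰ.Obj ] ℰ [ E′ , E ]) → arrow ℬ (p ₁ f) ≡ arrow ℬ σ

IsOpfibration : {ℰ ℬ : Category ℓ} → Functor ℰ ℬ → Set ℓ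
IsOpfibration p = IsFibration (opF p)

record Presheaf (𝒞 : Category ℓ) : Set (suc ℓ) where
  open Category 𝒞
  field
    F₀   : Obj → Set ℓ
    F₁   : ∀ {A B} → A ⇒ B → F₀ B → F₀ A
    F-id : ∀ {A} (x : F₀ A) → F₁ id x ≡ x
    F-∘  : ∀ {A B C} (g : B ⇒ C) (f : A ⇒ B) (x : F₀ C) → F₁ (g ∘ f) x ≡ F₁ f (F₁ g x)

record PresheafMap {𝒞 : Category ℓ} (X Y : Presheaf 𝒞) : Set ℓ where
  private
    module X = Presheaf X
    module Y = Presheaf Y
  field
    map     : ∀ {A} → X.F₀ A → Y.F₀ A
    natural : ∀ {A B} (f : 𝒞 [ A , B ]) (x : X.F₀ B) → map (X.F₁ f x) ≡ Y.F₁ f (map x)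

open PresheafMap public using (map)

PSh : Category ℓ → ECategory (suc ℓ) ℓ ℓ
PSh 𝒞 = record
  { Obj       = Presheaf 𝒞
  ; _⇒_       = PresheafMap
  ; _≈_       = λ α β → ∀ {A} x → map α {A} x ≡ map β x
  ; id        = record { map = λ x → x ; natural = λ _ _ → refl }
  ; _∘_       = λ β α → record
      { map     = λ x → map β (map α x)
      ; natural = λ f x →
          trans (cong (map β) (PresheafMap.natural α f x)) (PresheafMap.natural β f (map α x))
      }
  ; assoc     = λ _ _ _ _ → refl
  ; identityˡ = λ _ _ → refl
  ; identityʳ = λ _ _ → refl
  ; equiv     = record
      { refl  = λ _ → refl
      ; sym   = λ p x → sym (p x)
      ; trans = λ p q x → trans (p x) (q x)
      }
  ; ∘-resp-≈  = λ {_} {_} {_} {_} {β′} {α} p q x → trans (p (map α x)) (cong (map β′) (q x))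
  }

module _ {𝒞 : Category ℓ} where
  open Category 𝒞

  𝐲 : Obj → Presheaf 𝒞
  𝐲 A = record
    { F₀   = _⇒ A
    ; F₁   = λ f g → g ∘ f
    ; F-id = identityʳ
    ; F-∘  = λ g f k → sym (assoc k g f)
    }

  𝐲₁ : ∀ {A B} → A ⇒ B → PresheafMap (𝐲 A) (𝐲 B)
  𝐲₁ f = record { map = f ∘_ ; natural = λ g k → sym (assoc f k g) }

  ⌜_⌝ : ∀ {X : Presheaf 𝒞} {A} → Presheaf.F₀ X A → PresheafMap (𝐲 A) X
  ⌜_⌝ {X} x = record
    { map     = λ f → Presheaf.F₁ X f x
    ; natural = λ f g → Presheaf.F-∘ X g f x
    }

module _ {𝒞 : Category ℓ} where
  open Category 𝒞

  ∫ : Presheaf 𝒞 → Category ℓ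
  ∫ X = record
    { Obj       = Σ[ A ∈ Obj ] X.F₀ A
    ; _⇒_       = λ (A , x) (B , y) → Σ[ f ∈ A ⇒ B ] X.F₁ f y ≡ x
    ; id        = id , X.F-id _
    ; _∘_       = λ (g , q) (f , p) → g ∘ f , trans (X.F-∘ g f _) (trans (cong (X.F₁ f) q) p)
    ; assoc     = λ k g f → ext (assoc (proj₁ k) (proj₁ g) (proj₁ f))
    ; identityˡ = λ f → ext (identityˡ (proj₁ f))
    ; identityʳ = λ f → ext (identityʳ (proj₁ f))
    }
    where
    module X = Presheaf X

    ext : ∀ {A B x y} {f g : Σ[ f ∈ A ⇒ B ] X.F₁ f y ≡ x} → proj₁ f ≡ proj₁ g → f ≡ g
    ext {f = _ , refl} {g = _ , refl} refl = refl

  ∫π : (X : Presheaf 𝒞) → Functor (∫ X) 𝒞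
  ∫π X = record { F₀ = proj₁ ; F₁ = proj₁ ; F-id = refl ; F-∘ = λ _ _ → refl }

  ∫₁ : {X Y : Presheaf 𝒞} → PresheafMap X Y → Functor (∫ X) (∫ Y)
  ∫₁ {X} {Y} α = record
    { F₀   = λ (A , x) → A , map α x
    ; F₁   = λ (f , p) → f , trans (sym (PresheafMap.natural α f _)) (cong (map α) p)
    ; F-id = ext refl
    ; F-∘  = λ _ _ → ext refl
    }
    where
    module Y = Presheaf Y

    ext : ∀ {A B x y} {f g : Σ[ f ∈ A ⇒ B ] Y.F₁ f y ≡ x} → proj₁ f ≡ proj₁ g → f ≡ g
    ext {f = _ , refl} {g = _ , refl} refl = refl

module _ (ctx : Category ℓ) where
  open Category ctx

  -- Extensions are indexed by the elements A ∈ U(Γ) rather than by the maps yΓ → U,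
  -- so that they do not depend on the naturality proof carried by such a map.

  record NaturalModel : Set (suc ℓ) where
    no-eta-equality
    infixl 5 _▹_
    field
      U U̇      : Presheaf ctx
      p        : PresheafMap U̇ U
      _▹_      : ∀ Γ → Presheaf.F₀ U Γ → Obj
      δ        : ∀ {Γ} (A : Presheaf.F₀ U Γ) → Γ ▹ A ⇒ Γ
      q        : ∀ {Γ} (A : Presheaf.F₀ U Γ) → PresheafMap (𝐲 (Γ ▹ A)) U̇
      pullback : ∀ {Γ} (A : Presheaf.F₀ U Γ) →
                 IsPullback (PSh ctx) (q A) (𝐲₁ (δ A)) p (⌜_⌝ {X = U} A)

    generic : ∀ {Γ} (A : Presheaf.F₀ U Γ) → Presheaf.F₀ U̇ (Γ ▹ A)
    generic A = map (q A) id

  -- Morphisms over ctx preserve the chosen representability data on the nose;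
  -- an equality of the maps q is stated on the corresponding elements.

  record NMMap (M N : NaturalModel) : Set ℓ where
    no-eta-equality
    private
      module M = NaturalModel M
      module N = NaturalModel N
    field
      ty      : PresheafMap M.U N.U
      tm      : PresheafMap M.U̇ N.U̇
      commute : ∀ {Γ} (a : Presheaf.F₀ M.U̇ Γ) → map N.p (map tm a) ≡ map ty (map M.p a)
      pres-δ  : ∀ {Γ} (A : Presheaf.F₀ M.U Γ) →
                arrow ctx (M.δ A) ≡ arrow ctx (N.δ (map ty A))
      pres-q  : ∀ {Γ} (A : Presheaf.F₀ M.U Γ) →
                _≡_ {A = Σ Obj (Presheaf.F₀ N.U̇)}
                    (Γ M.▹ A , map tm (M.generic A))
                    (Γ N.▹ map ty A , N.generic (map ty A))

  NaturalModels : ECategory (suc ℓ) ℓ ℓ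
  NaturalModels = record
    { Obj       = NaturalModel
    ; _⇒_       = NMMap
    ; _≈_       = λ φ ψ → (ty φ ≈ ty ψ) × (tm φ ≈ tm ψ)
    ; id        = record
        { ty = P.id ; tm = P.id ; commute = λ _ → refl ; pres-δ = λ _ → refl ; pres-q = λ _ → refl }
    ; _∘_       = λ {L} {M} {N} ψ φ → record
        { ty      = ty ψ P.∘ ty φ
        ; tm      = tm ψ P.∘ tm φ
        ; commute = λ a → trans (commute ψ (map (tm φ) a)) (cong (map (ty ψ)) (commute φ a))
        ; pres-δ  = λ A → trans (pres-δ φ A) (pres-δ ψ (map (ty φ) A))
        ; pres-q  = λ A → trans (cong (λ (Γ , a) → Γ , map (tm ψ) a) (pres-q φ A))
                                (pres-q ψ (map (ty φ) A))
        }
    ; assoc     = λ _ _ _ → (λ _ → refl) , (λ _ → refl)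
    ; identityˡ = λ _ → (λ _ → refl) , (λ _ → refl)
    ; identityʳ = λ _ → (λ _ → refl) , (λ _ → refl)
    ; equiv     = record
        { refl  = (λ _ → refl) , (λ _ → refl)
        ; sym   = λ (p , q) → (λ x → sym (p x)) , (λ x → sym (q x))
        ; trans = λ (p , q) (p′ , q′) →
            (λ x → trans (p x) (p′ x)) , (λ x → trans (q x) (q′ x))
        }
    ; ∘-resp-≈  = λ {_} {_} {_} {ψ} {ψ′} {φ} {φ′} (p , q) (p′ , q′) →
        (λ x → trans (p (map (ty φ) x)) (cong (map (ty ψ′)) (p′ x))) ,
        (λ x → trans (q (map (tm φ) x)) (cong (map (tm ψ′)) (q′ x)))
    }
    where
    module P = ECategory (PSh ctx)
    open NMMap

    _≈_ : ∀ {X Y} → PresheafMap X Y → PresheafMap X Y → Set ℓ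
    _≈_ = P._≈_

-- A set of functors (of transformations) is a predicate invariant under strict
-- equality.

FunctorPredicate : (ℓ : Level) → Set (suc (suc ℓ))
FunctorPredicate ℓ = {𝒜 ℬ : Category ℓ} → Functor 𝒜 ℬ → Set (suc ℓ)

module _ {ctx : Category ℓ} (J : {𝒜 : Category ℓ} → Functor 𝒜 ctx → Set (suc ℓ))
         (R : FunctorPredicate ℓ) where

  data Composite : {𝒜 ℬ : Category ℓ} → Functor 𝒜 ℬ → Set (suc ℓ) where
    classifier : ∀ {𝒜} {F : Functor 𝒜 ctx} → J F → Composite F
    rule       : ∀ {𝒜 ℬ} {F : Functor 𝒜 ℬ} → R F → Composite F
    identity   : ∀ {𝒜} → Composite (idF 𝒜)
    compose    : ∀ {𝒜 ℬ 𝒞} {G : Functor ℬ 𝒞} {F : Functor 𝒜 ℬ} →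
                 Composite G → Composite F → Composite (G ∘F F)
    resp       : ∀ {𝒜 ℬ} {F G : Functor 𝒜 ℬ} → F ≡ᶠ G → Composite F → Composite G

-- Policies fill shapes bounded by composites of rules and judgement classifiers.
-- The empty composite is admitted because the unit and the counit of an adjunction
-- of rules are bounded by an identity functor.

record PreTheory (ctx : Category ℓ) : Set (suc (suc ℓ)) where
  no-eta-equality
  field
    Classifier      : {𝒜 : Category ℓ} → Functor 𝒜 ctx → Set (suc ℓ)
    Rule            : FunctorPredicate ℓ
    Policy          : {𝒜 ℬ : Category ℓ} {F G : Functor 𝒜 ℬ} → NatTrans F G → Set (suc ℓ)
    classifier-resp : ∀ {𝒜} {F G : Functor 𝒜 ctx} → F ≡ᶠ G → Classifier F → Classifier G
    rule-resp       : ∀ {𝒜 ℬ} {F G : Functor 𝒜 ℬ} → F ≡ᶠ G → Rule F → Rule G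
    policy-resp     : ∀ {𝒜 ℬ} {F G F′ G′ : Functor 𝒜 ℬ}
                      {α : NatTrans F G} {β : NatTrans F′ G′} → α ≋ β → Policy α → Policy β
    policy-boundary : ∀ {𝒜 ℬ} {F G : Functor 𝒜 ℬ} {α : NatTrans F G} → Policy α →
                      Composite {ctx = ctx} Classifier Rule F ×
                      Composite {ctx = ctx} Classifier Rule G

  data Category-of-theory (𝒳 : Category ℓ) : Set (suc ℓ) where
    dom : ∀ {ℬ} {F : Functor 𝒳 ℬ} → Rule F → Category-of-theory 𝒳
    cod : ∀ {𝒜} {F : Functor 𝒜 𝒳} → Rule F → Category-of-theory 𝒳

-- Limits are taken in the strict sense in Cat.  For each of them: the projections
-- are rules, a functor into the limit whose projections are rules is a rule, and a
-- transformation into the limit whose projections are policies is a policy.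

record IsJudgemental {ctx : Category ℓ} (T : PreTheory ctx) : Set (suc (suc ℓ)) where
  open PreTheory T
  field
    classifier⇒rule : ∀ {𝒜} {F : Functor 𝒜 ctx} → Classifier F → Rule F
    rule⇒classifier : ∀ {𝒜} {F : Functor 𝒜 ctx} → Rule F → Classifier F

    rule-∘ : ∀ {𝒜 ℬ 𝒞} {G : Functor ℬ 𝒞} {F : Functor 𝒜 ℬ} → Rule G → Rule F → Rule (G ∘F F)

    policy-• : ∀ {𝒜 ℬ} {F G H : Functor 𝒜 ℬ} {β : NatTrans G H} {α : NatTrans F G} →
               Policy β → Policy α → Policy (β • α)

    whiskerˡ : ∀ {𝒜 ℬ 𝒞} {H : Functor ℬ 𝒞} {F G : Functor 𝒜 ℬ} {α : NatTrans F G} →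
               Rule H → Policy α → Policy (H ∘ˡ α)
    whiskerʳ : ∀ {𝒜 ℬ 𝒞} {F G : Functor ℬ 𝒞} {α : NatTrans F G} {K : Functor 𝒜 ℬ} →
               Policy α → Rule K → Policy (α ∘ʳ K)

    pullback-projections :
      ∀ {𝒫 𝒜 ℬ 𝒞} {p₁ : Functor 𝒫 𝒜} {p₂ : Functor 𝒫 ℬ} {f : Functor 𝒜 𝒞} {g : Functor ℬ 𝒞} →
      IsPullback (Cat ℓ) p₁ p₂ f g → Rule f → Rule g → Rule p₁ × Rule p₂
    pullback-functor :
      ∀ {𝒫 𝒜 ℬ 𝒞} {p₁ : Functor 𝒫 𝒜} {p₂ : Functor 𝒫 ℬ} {f : Functor 𝒜 𝒞} {g : Functor ℬ 𝒞} →
      IsPullback (Cat ℓ) p₁ p₂ f g → Rule f → Rule g →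
      ∀ {𝒬} {m : Functor 𝒬 𝒫} → Rule (p₁ ∘F m) → Rule (p₂ ∘F m) → Rule m
    pullback-policy :
      ∀ {𝒫 𝒜 ℬ 𝒞} {p₁ : Functor 𝒫 𝒜} {p₂ : Functor 𝒫 ℬ} {f : Functor 𝒜 𝒞} {g : Functor ℬ 𝒞} →
      IsPullback (Cat ℓ) p₁ p₂ f g → Rule f → Rule g →
      ∀ {𝒬} {m n : Functor 𝒬 𝒫} {μ : NatTrans m n} → Rule m → Rule n →
      Policy (p₁ ∘ˡ μ) → Policy (p₂ ∘ˡ μ) → Policy μ

    equalizer-projection :
      ∀ {ℰ 𝒜 ℬ} {i : Functor ℰ 𝒜} {f g : Functor 𝒜 ℬ} →
      IsEqualizer (Cat ℓ) i f g → Rule f → Rule g → Rule i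
    equalizer-functor :
      ∀ {ℰ 𝒜 ℬ} {i : Functor ℰ 𝒜} {f g : Functor 𝒜 ℬ} →
      IsEqualizer (Cat ℓ) i f g → Rule f → Rule g →
      ∀ {𝒬} {m : Functor 𝒬 ℰ} → Rule (i ∘F m) → Rule m
    equalizer-policy :
      ∀ {ℰ 𝒜 ℬ} {i : Functor ℰ 𝒜} {f g : Functor 𝒜 ℬ} →
      IsEqualizer (Cat ℓ) i f g → Rule f → Rule g →
      ∀ {𝒬} {m n : Functor 𝒬 ℰ} {μ : NatTrans m n} → Rule m → Rule n →
      Policy (i ∘ˡ μ) → Policy μ

    power-projections :
      ∀ {n 𝒫 𝒳} {π : Fin n → Functor 𝒫 𝒳} →
      IsPower (Cat ℓ) π → Category-of-theory 𝒳 → ∀ i → Rule (π i)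
    power-functor :
      ∀ {n 𝒫 𝒳} {π : Fin n → Functor 𝒫 𝒳} →
      IsPower (Cat ℓ) π → Category-of-theory 𝒳 →
      ∀ {𝒬} {m : Functor 𝒬 𝒫} → Category-of-theory 𝒬 → (∀ i → Rule (π i ∘F m)) → Rule m
    power-policy :
      ∀ {n 𝒫 𝒳} {π : Fin n → Functor 𝒫 𝒳} →
      IsPower (Cat ℓ) π → Category-of-theory 𝒳 →
      ∀ {𝒬} {m k : Functor 𝒬 𝒫} {μ : NatTrans m k} → Rule m → Rule k →
      (∀ i → Policy (π i ∘ˡ μ)) → Policy μ

    -- L is (F , H) ↦ (λ F , H[σ_F]) and θ is its family of cartesian lifts.  The
    -- morphism τ is σ_F with its codomain r F rewritten to the equal object h H.
    ♯-lifting :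
      ∀ {ℱ 𝒢 𝒳 ℋ} {l : Functor ℱ 𝒢} {r : Functor ℱ 𝒳} {r′ : Functor 𝒢 𝒳} {h : Functor ℋ 𝒳}
      {σ : NatTrans (r′ ∘F l) r} →
      Rule l → Rule r → Rule r′ → Policy σ → Rule h → (fib : IsFibration h) →
      ∀ {𝒫 𝒬} {p₁ : Functor 𝒫 ℱ} {p₂ : Functor 𝒫 ℋ} {q₁ : Functor 𝒬 𝒢} {q₂ : Functor 𝒬 ℋ} →
      IsPullback (Cat ℓ) p₁ p₂ r h → IsPullback (Cat ℓ) q₁ q₂ r′ h →
      {L : Functor 𝒫 𝒬} {θ : NatTrans (q₂ ∘F L) p₂} →
      q₁ ∘F L ≡ᶠ l ∘F p₁ →
      (∀ x {I} (τ : 𝒳 [ I , h ₀ (p₂ ₀ x) ]) → arrow 𝒳 τ ≡ arrow 𝒳 (at σ (p₁ ₀ x)) →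
        arrow ℋ (at θ x) ≡ arrow ℋ (IsFibration.lift fib (p₂ ₀ x) τ)) →
      Rule L × Policy θ

    ♯-lifting-op :
      ∀ {ℱ 𝒢 𝒳 ℋ} {l : Functor ℱ 𝒢} {r : Functor ℱ 𝒳} {r′ : Functor 𝒢 𝒳} {h : Functor ℋ 𝒳}
      {σ : NatTrans r (r′ ∘F l)} →
      Rule l → Rule r → Rule r′ → Policy σ → Rule h → (opfib : IsOpfibration h) →
      ∀ {𝒫 𝒬} {p₁ : Functor 𝒫 ℱ} {p₂ : Functor 𝒫 ℋ} {q₁ : Functor 𝒬 𝒢} {q₂ : Functor 𝒬 ℋ} →
      IsPullback (Cat ℓ) p₁ p₂ r h → IsPullback (Cat ℓ) q₁ q₂ r′ h →
      {L : Functor 𝒫 𝒬} {θ : NatTrans p₂ (q₂ ∘F L)} →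
      q₁ ∘F L ≡ᶠ l ∘F p₁ →
      (∀ x {I} (τ : 𝒳 [ h ₀ (p₂ ₀ x) , I ]) → arrow 𝒳 τ ≡ arrow 𝒳 (at σ (p₁ ₀ x)) →
        arrow ℋ (at θ x) ≡ arrow ℋ (IsFibration.lift opfib (p₂ ₀ x) τ)) →
      Rule L × Policy θ

infix 4 _⊆_

record _⊆_ {ctx : Category ℓ} (S T : PreTheory ctx) : Set (suc (suc ℓ)) where
  private
    module S = PreTheory S
    module T = PreTheory T
  field
    classifiers : ∀ {𝒜} {F : Functor 𝒜 ctx} → S.Classifier F → T.Classifier F
    rules       : ∀ {𝒜 ℬ} {F : Functor 𝒜 ℬ} → S.Rule F → T.Rule F
    policies    : ∀ {𝒜 ℬ} {F G : Functor 𝒜 ℬ} {α : NatTrans F G} → S.Policy α → T.Policy α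

record _IsGeneratedBy_ {ctx : Category ℓ} (T S : PreTheory ctx) : Set (suc (suc ℓ)) where
  field
    judgemental : IsJudgemental T
    contains    : S ⊆ T
    least       : ∀ T′ → IsJudgemental T′ → S ⊆ T′ → T ⊆ T′

-- The generating pre-judgemental theory.  That it is substitutional is spelled out
-- in the last group of fields.  Substitutionality is a condition on the generators:
-- the generated theory also has the classifier u̇ ∘ Δ, which is not a fibration in
-- general.

record Presentation (ctx : Category ℓ) : Set (suc ℓ) where
  no-eta-equality
  field
    𝒰 𝒰̇  : Category ℓ
    u    : Functor 𝒰 ctx
    u̇    : Functor 𝒰̇ ctx
    Σᶠ   : Functor 𝒰̇ 𝒰
    Δᶠ   : Functor 𝒰 𝒰̇
    uΣ≡u̇ : u ∘F Σᶠ ≡ᶠ u̇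
    Σ⊣Δ  : Σᶠ ⊣ Δᶠ

  open _⊣_ Σ⊣Δ public using (η; ε)

  field
    u-fibration : IsFibration u
    u̇-fibration : IsFibration u̇
    Σ-cartesian : ∀ {a b} {f : 𝒰̇ [ a , b ]} → IsCartesian u̇ f → IsCartesian u (Σᶠ ₁ f)
    Δ-cartesian : ∀ {A B} {f : 𝒰 [ A , B ]} → IsCartesian u f → IsCartesian u̇ (Δᶠ ₁ f)
    η-cartesian : ∀ a → IsCartesian u̇ (at η a)
    ε-cartesian : ∀ A → IsCartesian u (at ε A)

module _ {ctx : Category ℓ} (D : Presentation ctx) where
  open Presentation D

  data GeneratingClassifier : {𝒜 : Category ℓ} → Functor 𝒜 ctx → Set (suc ℓ) where
    type-classifier : ∀ {F : Functor 𝒰 ctx} → u ≡ᶠ F → GeneratingClassifier F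
    term-classifier : ∀ {F : Functor 𝒰̇ ctx} → u̇ ≡ᶠ F → GeneratingClassifier F

  data GeneratingRule : {𝒜 ℬ : Category ℓ} → Functor 𝒜 ℬ → Set (suc ℓ) where
    typing    : ∀ {F : Functor 𝒰̇ 𝒰} → Σᶠ ≡ᶠ F → GeneratingRule F
    extension : ∀ {F : Functor 𝒰 𝒰̇} → Δᶠ ≡ᶠ F → GeneratingRule F

  data GeneratingPolicy :
       {𝒜 ℬ : Category ℓ} {F G : Functor 𝒜 ℬ} → NatTrans F G → Set (suc ℓ) where
    witness : ∀ {F G : Functor 𝒰̇ ctx} {α : NatTrans F G} →
              identityTransformation uΣ≡u̇ ≋ α → GeneratingPolicy α
    unit    : ∀ {F G : Functor 𝒰̇ 𝒰̇} {α : NatTrans F G} → η ≋ α → GeneratingPolicy α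
    counit  : ∀ {F G : Functor 𝒰 𝒰} {α : NatTrans F G} → ε ≋ α → GeneratingPolicy α

  private
    ≋-trans : ∀ {𝒜 ℬ : Category ℓ} {F G F′ G′ F″ G″ : Functor 𝒜 ℬ}
              {α : NatTrans F G} {β : NatTrans F′ G′} {γ : NatTrans F″ G″} →
              α ≋ β → β ≋ γ → α ≋ γ
    ≋-trans p q = record
      { source     = ≡ᶠ-trans p.source q.source
      ; target     = ≡ᶠ-trans p.target q.target
      ; components = λ A → trans (p.components A) (q.components A)
      }
      where
      module p = _≋_ p
      module q = _≋_ q

    C : {𝒜 ℬ : Category ℓ} → Functor 𝒜 ℬ → Set (suc ℓ)
    C = Composite {ctx = ctx} GeneratingClassifier GeneratingRule

    Σ-composite : C Σᶠ
    Σ-composite = rule (typing ≡ᶠ-refl)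

    Δ-composite : C Δᶠ
    Δ-composite = rule (extension ≡ᶠ-refl)

    boundary : ∀ {𝒜 ℬ} {F G : Functor 𝒜 ℬ} {α : NatTrans F G} → GeneratingPolicy α → C F × C G
    boundary (witness p) =
      resp (_≋_.source p) (compose (classifier (type-classifier ≡ᶠ-refl)) Σ-composite) ,
      resp (_≋_.target p) (classifier (term-classifier ≡ᶠ-refl))
    boundary (unit p) =
      resp (_≋_.source p) identity ,
      resp (_≋_.target p) (compose Δ-composite Σ-composite)
    boundary (counit p) =
      resp (_≋_.source p) (compose Σ-composite Δ-composite) ,
      resp (_≋_.target p) identity

  generators : PreTheory ctx
  generators = record
    { Classifier      = GeneratingClassifier
    ; Rule            = GeneratingRule
    ; Policy          = GeneratingPolicy
    ; classifier-resp = λ { p (type-classifier q) → type-classifier (≡ᶠ-trans q p)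
                          ; p (term-classifier q) → term-classifier (≡ᶠ-trans q p) }
    ; rule-resp       = λ { p (typing q)    → typing (≡ᶠ-trans q p)
                          ; p (extension q) → extension (≡ᶠ-trans q p) }
    ; policy-resp     = λ { p (witness q) → witness (≋-trans q p)
                          ; p (unit q)    → unit (≋-trans q p)
                          ; p (counit q)  → counit (≋-trans q p) }
    ; policy-boundary = boundary
    }

record PlainDTT (ctx : Category ℓ) : Set (suc (suc ℓ)) where
  no-eta-equality
  field
    presentation : Presentation ctx
    theory       : PreTheory ctx
    generated    : theory IsGeneratedBy generators presentation

  open Presentation presentation public

record DiscretePlainDTT (ctx : Category ℓ) : Set (suc (suc ℓ)) where
  no-eta-equality
  field
    plainDTT   : PlainDTT ctx
    u-discrete : IsDiscreteFibration (PlainDTT.u plainDTT)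
    u̇-discrete : IsDiscreteFibration (PlainDTT.u̇ plainDTT)

  open PlainDTT plainDTT public

-- Morphisms over ctx preserve Σ ⊣ Δ on the nose.  The generated theory is
-- determined by the generators and imposes no further condition.

record DTTMap {ctx : Category ℓ} (S T : DiscretePlainDTT ctx) : Set ℓ where
  no-eta-equality
  private
    module S = DiscretePlainDTT S
    module T = DiscretePlainDTT T
  field
    ty     : Functor S.𝒰 T.𝒰
    tm     : Functor S.𝒰̇ T.𝒰̇
    over-u : T.u ∘F ty ≡ᶠ S.u
    over-u̇ : T.u̇ ∘F tm ≡ᶠ S.u̇
    pres-Σ : ty ∘F S.Σᶠ ≡ᶠ T.Σᶠ ∘F tm
    pres-Δ : tm ∘F S.Δᶠ ≡ᶠ T.Δᶠ ∘F ty
    pres-η : ∀ a → arrow T.𝒰̇ (tm ₁ at S.η a) ≡ arrow T.𝒰̇ (at T.η (tm ₀ a))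
    pres-ε : ∀ A → arrow T.𝒰 (ty ₁ at S.ε A) ≡ arrow T.𝒰 (at T.ε (ty ₀ A))

module _ {ctx : Category ℓ} where
  open DTTMap
  open Functor using (onArrow)

  record _≈ᵀ_ {S T : DiscretePlainDTT ctx} (φ ψ : DTTMap S T) : Set ℓ where
    constructor mk≈ᵀ
    field
      ≡ᶠ-ty : ty φ ≡ᶠ ty ψ
      ≡ᶠ-tm : tm φ ≡ᶠ tm ψ

  open _≈ᵀ_ public

  idᵀ : {T : DiscretePlainDTT ctx} → DTTMap T T
  idᵀ .ty     = idF _
  idᵀ .tm     = idF _
  idᵀ .over-u = mk≡ᶠ λ _ → refl
  idᵀ .over-u̇ = mk≡ᶠ λ _ → refl
  idᵀ .pres-Σ = mk≡ᶠ λ _ → refl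
  idᵀ .pres-Δ = mk≡ᶠ λ _ → refl
  idᵀ .pres-η = λ _ → refl
  idᵀ .pres-ε = λ _ → refl

  infixr 9 _∘ᵀ_

  _∘ᵀ_ : {R S T : DiscretePlainDTT ctx} → DTTMap S T → DTTMap R S → DTTMap R T
  (ψ ∘ᵀ φ) .ty     = ty ψ ∘F ty φ
  (ψ ∘ᵀ φ) .tm     = tm ψ ∘F tm φ
  (ψ ∘ᵀ φ) .over-u = mk≡ᶠ λ f → trans (on-arrow (over-u ψ) (ty φ ₁ f)) (on-arrow (over-u φ) f)
  (ψ ∘ᵀ φ) .over-u̇ = mk≡ᶠ λ f → trans (on-arrow (over-u̇ ψ) (tm φ ₁ f)) (on-arrow (over-u̇ φ) f)
  (ψ ∘ᵀ φ) .pres-Σ = mk≡ᶠ λ f → trans (cong (onArrow (ty ψ)) (on-arrow (pres-Σ φ) f))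
                                     (on-arrow (pres-Σ ψ) (tm φ ₁ f))
  (ψ ∘ᵀ φ) .pres-Δ = mk≡ᶠ λ f → trans (cong (onArrow (tm ψ)) (on-arrow (pres-Δ φ) f))
                                     (on-arrow (pres-Δ ψ) (ty φ ₁ f))
  (ψ ∘ᵀ φ) .pres-η a = trans (cong (onArrow (tm ψ)) (pres-η φ a)) (pres-η ψ (tm φ ₀ a))
  (ψ ∘ᵀ φ) .pres-ε A = trans (cong (onArrow (ty ψ)) (pres-ε φ A)) (pres-ε ψ (ty φ ₀ A))

DiscretePlainDTTs : Category ℓ → ECategory (suc (suc ℓ)) ℓ ℓ
DiscretePlainDTTs ctx = record
  { Obj       = DiscretePlainDTT ctx
  ; _⇒_       = DTTMap
  ; _≈_       = _≈ᵀ_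
  ; id        = idᵀ
  ; _∘_       = _∘ᵀ_
  ; assoc     = λ _ _ _ → mk≈ᵀ (mk≡ᶠ λ _ → refl) (mk≡ᶠ λ _ → refl)
  ; identityˡ = λ _ → mk≈ᵀ (mk≡ᶠ λ _ → refl) (mk≡ᶠ λ _ → refl)
  ; identityʳ = λ _ → mk≈ᵀ (mk≡ᶠ λ _ → refl) (mk≡ᶠ λ _ → refl)
  ; equiv     = record
      { refl  = mk≈ᵀ ≡ᶠ-refl ≡ᶠ-refl
      ; sym   = λ p → mk≈ᵀ (≡ᶠ-sym (≡ᶠ-ty p)) (≡ᶠ-sym (≡ᶠ-tm p))
      ; trans = λ p q → mk≈ᵀ (≡ᶠ-trans (≡ᶠ-ty p) (≡ᶠ-ty q)) (≡ᶠ-trans (≡ᶠ-tm p) (≡ᶠ-tm q))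
      }
  ; ∘-resp-≈  = λ p q → mk≈ᵀ (∘F-resp-≡ᶠ (≡ᶠ-ty p) (≡ᶠ-ty q)) (∘F-resp-≡ᶠ (≡ᶠ-tm p) (≡ᶠ-tm q))
  }

-- T is the type theory of M: its fibrations are the categories of elements of U and
-- U̇, Σ is p, Δ A is the generic term q_A, and ε_A lies over δ_A.

record Realises {ctx : Category ℓ} (M : NaturalModel ctx) (T : DiscretePlainDTT ctx)
       : Set ℓ where
  private
    module M = NaturalModel M
    module T = DiscretePlainDTT T
  field
    types : Iso (Cat ℓ) (∫ M.U) T.𝒰
    terms : Iso (Cat ℓ) (∫ M.U̇) T.𝒰̇

  typeOf : Functor (∫ M.U) T.𝒰
  typeOf = Iso.to types

  termOf : Functor (∫ M.U̇) T.𝒰̇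
  termOf = Iso.to terms

  field
    over-u : T.u ∘F typeOf ≡ᶠ ∫π M.U
    over-u̇ : T.u̇ ∘F termOf ≡ᶠ ∫π M.U̇
    Σ-is-p : T.Σᶠ ∘F termOf ≡ᶠ typeOf ∘F ∫₁ M.p
    Δ-is-q : ∀ {Γ} (A : Presheaf.F₀ M.U Γ) →
             T.Δᶠ ₀ (typeOf ₀ (Γ , A)) ≡ termOf ₀ (Γ M.▹ A , M.generic A)
    ε-is-δ : ∀ {Γ} (A : Presheaf.F₀ M.U Γ) →
             arrow ctx (T.u ₁ at T.ε (typeOf ₀ (Γ , A))) ≡ arrow ctx (M.δ A)

record RealisesNaturally {ctx : Category ℓ}
       (K : EFunctor (NaturalModels ctx) (DiscretePlainDTTs ctx)) : Set (suc ℓ) where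
  private
    module K = EFunctor K
  field
    realises : ∀ M → Realises M (K.F₀ M)
  private
    module R M = Realises (realises M)
  field
    natural-types : ∀ {M N} (φ : NMMap ctx M N) →
                    R.typeOf N ∘F ∫₁ (NMMap.ty φ) ≡ᶠ DTTMap.ty (K.F₁ φ) ∘F R.typeOf M
    natural-terms : ∀ {M N} (φ : NMMap ctx M N) →
                    R.termOf N ∘F ∫₁ (NMMap.tm φ) ≡ᶠ DTTMap.tm (K.F₁ φ) ∘F R.termOf M

{-# OPTIONS --safe #-}
module Submission where

-- Discrete fibrations over ctx are categories of elements of presheaves.  Under this
-- correspondence p becomes Σ, and the extension square of A, tested on elements, says
-- that a map Σ a → A is the same thing as a map a → (Γ.A , q_A): it exhibits the generic
-- term as the value at A of a right adjoint of Σ whose counit is δ_A.  Cartesianness is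
-- automatic, as every morphism of a discrete fibration is cartesian.

open import Level using (Level; suc)
open import Data.Fin.Base using (Fin)
open import Data.Product using (Σ; Σ-syntax; ∃!; _×_; _,_; proj₁; proj₂)
open import Data.Unit.Polymorphic.Base using (⊤; tt)
open import Relation.Binary.PropositionalEquality
  using (_≡_; refl; sym; trans; cong)
open import Defs

-- Two obstacles shape the construction. Minimality quantifies over all pre-theories, so
-- intersecting them would yield predicates one universe too high; the generated theory is an
-- inductive family instead. And the objects of a fibre lie over their context only up to
-- propositional equality, so many equations relate morphisms with different endpoints. These are
-- stated through `arrow`, and wherever possible uniqueness of lifts reduces them to an equation in
-- `ctx` and an equality of codomains.

private
  variable
    ℓ : Level

-- The generated judgemental theory

module _ (ℓ : Level) where

  -- `isCategory` stands in for `Category-of-theory`, which presupposes a finished `PreTheory` and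
  -- so cannot occur while the theory is being generated.
  data Item : Set (suc ℓ) where
    isRule     : {𝒜 ℬ : Category ℓ} → Functor 𝒜 ℬ → Item
    isPolicy   : {𝒜 ℬ : Category ℓ} {F G : Functor 𝒜 ℬ} → NatTrans F G → Item
    isCategory : Category ℓ → Item
    _and_      : Item → Item → Item

module _ {ctx : Category ℓ} (S : PreTheory ctx) where
  private
    module S = PreTheory S

  -- Rules, policies and categories of the theory are generated simultaneously.  The
  -- constructors are the closure conditions of IsJudgemental, one for one, so
  -- conditions with two conclusions produce a pair of items.

  data Generated : Item ℓ → Set (suc ℓ)

  GeneratedRule : FunctorPredicate ℓ
  GeneratedRule F = Generated (isRule F)

  GeneratedPolicy : {𝒜 ℬ : Category ℓ} {F G : Functor 𝒜 ℬ} → NatTrans F G → Set (suc ℓ)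
  GeneratedPolicy α = Generated (isPolicy α)

  data Generated where
    first  : ∀ {i j} → Generated (i and j) → Generated i
    second : ∀ {i j} → Generated (i and j) → Generated j

    classifier-generator : ∀ {𝒜} {F : Functor 𝒜 ctx} → S.Classifier F → GeneratedRule F
    rule-generator       : ∀ {𝒜 ℬ} {F : Functor 𝒜 ℬ} → S.Rule F → GeneratedRule F
    policy-generator     : ∀ {𝒜 ℬ} {F G : Functor 𝒜 ℬ} {α : NatTrans F G} →
                           S.Policy α → GeneratedPolicy α
    rule-resp            : ∀ {𝒜 ℬ} {F G : Functor 𝒜 ℬ} →
                           F ≡ᶠ G → GeneratedRule F → GeneratedRule G
    policy-resp          : ∀ {𝒜 ℬ} {F G F′ G′ : Functor 𝒜 ℬ}
                           {α : NatTrans F G} {β : NatTrans F′ G′} →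
                           α ≋ β → GeneratedPolicy α → GeneratedPolicy β
    domain               : ∀ {𝒜 ℬ} {F : Functor 𝒜 ℬ} → GeneratedRule F → Generated (isCategory 𝒜)
    codomain             : ∀ {𝒜 ℬ} {F : Functor 𝒜 ℬ} → GeneratedRule F → Generated (isCategory ℬ)

    rule-∘   : ∀ {𝒜 ℬ 𝒞} {G : Functor ℬ 𝒞} {F : Functor 𝒜 ℬ} →
               GeneratedRule G → GeneratedRule F → GeneratedRule (G ∘F F)
    policy-• : ∀ {𝒜 ℬ} {F G H : Functor 𝒜 ℬ} {β : NatTrans G H} {α : NatTrans F G} →
               GeneratedPolicy β → GeneratedPolicy α → GeneratedPolicy (β • α)
    whiskerˡ : ∀ {𝒜 ℬ 𝒞} {H : Functor ℬ 𝒞} {F G : Functor 𝒜 ℬ} {α : NatTrans F G} →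
               GeneratedRule H → GeneratedPolicy α → GeneratedPolicy (H ∘ˡ α)
    whiskerʳ : ∀ {𝒜 ℬ 𝒞} {F G : Functor ℬ 𝒞} {α : NatTrans F G} {K : Functor 𝒜 ℬ} →
               GeneratedPolicy α → GeneratedRule K → GeneratedPolicy (α ∘ʳ K)

    pullback-projections :
      ∀ {𝒫 𝒜 ℬ 𝒞} {p₁ : Functor 𝒫 𝒜} {p₂ : Functor 𝒫 ℬ} {f : Functor 𝒜 𝒞} {g : Functor ℬ 𝒞} →
      IsPullback (Cat ℓ) p₁ p₂ f g → GeneratedRule f → GeneratedRule g →
      Generated (isRule p₁ and isRule p₂)
    pullback-functor :
      ∀ {𝒫 𝒜 ℬ 𝒞} {p₁ : Functor 𝒫 𝒜} {p₂ : Functor 𝒫 ℬ} {f : Functor 𝒜 𝒞} {g : Functor ℬ 𝒞} →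
      IsPullback (Cat ℓ) p₁ p₂ f g → GeneratedRule f → GeneratedRule g →
      ∀ {𝒬} {m : Functor 𝒬 𝒫} → GeneratedRule (p₁ ∘F m) → GeneratedRule (p₂ ∘F m) →
      GeneratedRule m
    pullback-policy :
      ∀ {𝒫 𝒜 ℬ 𝒞} {p₁ : Functor 𝒫 𝒜} {p₂ : Functor 𝒫 ℬ} {f : Functor 𝒜 𝒞} {g : Functor ℬ 𝒞} →
      IsPullback (Cat ℓ) p₁ p₂ f g → GeneratedRule f → GeneratedRule g →
      ∀ {𝒬} {m n : Functor 𝒬 𝒫} {μ : NatTrans m n} → GeneratedRule m → GeneratedRule n →
      GeneratedPolicy (p₁ ∘ˡ μ) → GeneratedPolicy (p₂ ∘ˡ μ) → GeneratedPolicy μ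

    equalizer-projection :
      ∀ {ℰ 𝒜 ℬ} {i : Functor ℰ 𝒜} {f g : Functor 𝒜 ℬ} →
      IsEqualizer (Cat ℓ) i f g → GeneratedRule f → GeneratedRule g → GeneratedRule i
    equalizer-functor :
      ∀ {ℰ 𝒜 ℬ} {i : Functor ℰ 𝒜} {f g : Functor 𝒜 ℬ} →
      IsEqualizer (Cat ℓ) i f g → GeneratedRule f → GeneratedRule g →
      ∀ {𝒬} {m : Functor 𝒬 ℰ} → GeneratedRule (i ∘F m) → GeneratedRule m
    equalizer-policy :
      ∀ {ℰ 𝒜 ℬ} {i : Functor ℰ 𝒜} {f g : Functor 𝒜 ℬ} →
      IsEqualizer (Cat ℓ) i f g → GeneratedRule f → GeneratedRule g →
      ∀ {𝒬} {m n : Functor 𝒬 ℰ} {μ : NatTrans m n} → GeneratedRule m → GeneratedRule n →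
      GeneratedPolicy (i ∘ˡ μ) → GeneratedPolicy μ

    power-projections :
      ∀ {n 𝒫 𝒳} {π : Fin n → Functor 𝒫 𝒳} →
      IsPower (Cat ℓ) π → Generated (isCategory 𝒳) → ∀ i → GeneratedRule (π i)
    power-functor :
      ∀ {n 𝒫 𝒳} {π : Fin n → Functor 𝒫 𝒳} →
      IsPower (Cat ℓ) π → Generated (isCategory 𝒳) →
      ∀ {𝒬} {m : Functor 𝒬 𝒫} → Generated (isCategory 𝒬) →
      (∀ i → GeneratedRule (π i ∘F m)) → GeneratedRule m
    power-policy :
      ∀ {n 𝒫 𝒳} {π : Fin n → Functor 𝒫 𝒳} →
      IsPower (Cat ℓ) π → Generated (isCategory 𝒳) →
      ∀ {𝒬} {m k : Functor 𝒬 𝒫} {μ : NatTrans m k} → GeneratedRule m → GeneratedRule k →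
      (∀ i → GeneratedPolicy (π i ∘ˡ μ)) → GeneratedPolicy μ

    ♯-lifting :
      ∀ {ℱ 𝒢 𝒳 ℋ} {l : Functor ℱ 𝒢} {r : Functor ℱ 𝒳} {r′ : Functor 𝒢 𝒳} {h : Functor ℋ 𝒳}
      {σ : NatTrans (r′ ∘F l) r} →
      GeneratedRule l → GeneratedRule r → GeneratedRule r′ → GeneratedPolicy σ →
      GeneratedRule h → (fib : IsFibration h) →
      ∀ {𝒫 𝒬} {p₁ : Functor 𝒫 ℱ} {p₂ : Functor 𝒫 ℋ} {q₁ : Functor 𝒬 𝒢} {q₂ : Functor 𝒬 ℋ} →
      IsPullback (Cat ℓ) p₁ p₂ r h → IsPullback (Cat ℓ) q₁ q₂ r′ h →
      {L : Functor 𝒫 𝒬} {θ : NatTrans (q₂ ∘F L) p₂} →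
      q₁ ∘F L ≡ᶠ l ∘F p₁ →
      (∀ x {I} (τ : 𝒳 [ I , h ₀ (p₂ ₀ x) ]) → arrow 𝒳 τ ≡ arrow 𝒳 (at σ (p₁ ₀ x)) →
        arrow ℋ (at θ x) ≡ arrow ℋ (IsFibration.lift fib (p₂ ₀ x) τ)) →
      Generated (isRule L and isPolicy θ)
    ♯-lifting-op :
      ∀ {ℱ 𝒢 𝒳 ℋ} {l : Functor ℱ 𝒢} {r : Functor ℱ 𝒳} {r′ : Functor 𝒢 𝒳} {h : Functor ℋ 𝒳}
      {σ : NatTrans r (r′ ∘F l)} →
      GeneratedRule l → GeneratedRule r → GeneratedRule r′ → GeneratedPolicy σ →
      GeneratedRule h → (opfib : IsOpfibration h) →
      ∀ {𝒫 𝒬} {p₁ : Functor 𝒫 ℱ} {p₂ : Functor 𝒫 ℋ} {q₁ : Functor 𝒬 𝒢} {q₂ : Functor 𝒬 ℋ} →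
      IsPullback (Cat ℓ) p₁ p₂ r h → IsPullback (Cat ℓ) q₁ q₂ r′ h →
      {L : Functor 𝒫 𝒬} {θ : NatTrans p₂ (q₂ ∘F L)} →
      q₁ ∘F L ≡ᶠ l ∘F p₁ →
      (∀ x {I} (τ : 𝒳 [ h ₀ (p₂ ₀ x) , I ]) → arrow 𝒳 τ ≡ arrow 𝒳 (at σ (p₁ ₀ x)) →
        arrow ℋ (at θ x) ≡ arrow ℋ (IsFibration.lift opfib (p₂ ₀ x) τ)) →
      Generated (isRule L and isPolicy θ)

  GeneratedComposite : FunctorPredicate ℓ
  GeneratedComposite = Composite {ctx = ctx} (λ F → GeneratedRule F) (λ F → GeneratedRule F)

  Boundary : Item ℓ → Set (suc ℓ)
  Boundary (isRule F)                = ⊤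
  Boundary (isPolicy {F = F} {G} α)  = GeneratedComposite F × GeneratedComposite G
  Boundary (isCategory 𝒳)            = ⊤
  Boundary (i and j)                 = Boundary i × Boundary j

  composite-generators : ∀ {𝒜 ℬ} {F : Functor 𝒜 ℬ} →
                         Composite {ctx = ctx} S.Classifier S.Rule F → GeneratedComposite F
  composite-generators (classifier x) = classifier (classifier-generator x)
  composite-generators (rule x)       = rule (rule-generator x)
  composite-generators identity       = identity
  composite-generators (compose x y)  = compose (composite-generators x) (composite-generators y)
  composite-generators (resp p x)     = resp p (composite-generators x)

  -- `policy-boundary` is a field of a pre-theory and not a closure condition, so it is recovered by
  -- induction. A policy into a limit carries the two rules that bound it as premises.
  boundary : ∀ {i} → Generated i → Boundary i
  boundary (first x)                  = proj₁ (boundary x)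
  boundary (second x)                 = proj₂ (boundary x)
  boundary (classifier-generator x)   = tt
  boundary (rule-generator x)         = tt
  boundary (policy-generator x)       =
    let s , t = S.policy-boundary x in composite-generators s , composite-generators t
  boundary (rule-resp p x)            = tt
  boundary (policy-resp p x)          =
    let s , t = boundary x in resp (_≋_.source p) s , resp (_≋_.target p) t
  boundary (domain x)                 = tt
  boundary (codomain x)               = tt
  boundary (rule-∘ x y)               = tt
  boundary (policy-• x y)             = proj₁ (boundary y) , proj₂ (boundary x)
  boundary (whiskerˡ r x)             =
    let s , t = boundary x in compose (rule r) s , compose (rule r) t
  boundary (whiskerʳ x r)             =
    let s , t = boundary x in compose s (rule r) , compose t (rule r)
  boundary (pullback-projections _ _ _)      = tt , tt
  boundary (pullback-functor _ _ _ _ _)      = tt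
  boundary (pullback-policy _ _ _ m n _ _)   = rule m , rule n
  boundary (equalizer-projection _ _ _)      = tt
  boundary (equalizer-functor _ _ _ _)       = tt
  boundary (equalizer-policy _ _ _ m n _)    = rule m , rule n
  boundary (power-projections _ _ _)         = tt
  boundary (power-functor _ _ _ _)           = tt
  boundary (power-policy _ _ m k _)          = rule m , rule k
  -- `θ` runs from `q₂ ∘F L` to `p₂`. The projections are rules by closure under pullbacks, and `L`
  -- is a rule by the first half of the pair `g` itself.
  boundary g@(♯-lifting _ r r′ _ h _ pb pb′ _ _) =
    tt , compose (rule (second (pullback-projections pb′ r′ h))) (rule (first g)) ,
         rule (second (pullback-projections pb r h))
  boundary g@(♯-lifting-op _ r r′ _ h _ pb pb′ _ _) =
    tt , rule (second (pullback-projections pb r h)) ,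
         compose (rule (second (pullback-projections pb′ r′ h))) (rule (first g))

  generatedTheory : PreTheory ctx
  generatedTheory .PreTheory.Classifier F    = GeneratedRule F
  generatedTheory .PreTheory.Rule F          = GeneratedRule F
  generatedTheory .PreTheory.Policy α        = GeneratedPolicy α
  generatedTheory .PreTheory.classifier-resp = rule-resp
  generatedTheory .PreTheory.rule-resp       = rule-resp
  generatedTheory .PreTheory.policy-resp     = policy-resp
  generatedTheory .PreTheory.policy-boundary = boundary

  private
    category : ∀ {𝒳} → PreTheory.Category-of-theory generatedTheory 𝒳 → Generated (isCategory 𝒳)
    category (PreTheory.dom r) = domain r
    category (PreTheory.cod r) = codomain r

  generatedTheory-judgemental : IsJudgemental generatedTheory
  generatedTheory-judgemental = record
    { classifier⇒rule      = λ x → x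
    ; rule⇒classifier      = λ x → x
    ; rule-∘               = rule-∘
    ; policy-•             = policy-•
    ; whiskerˡ             = whiskerˡ
    ; whiskerʳ             = whiskerʳ
    ; pullback-projections = λ pb f g →
        let x = pullback-projections pb f g in first x , second x
    ; pullback-functor     = pullback-functor
    ; pullback-policy      = pullback-policy
    ; equalizer-projection = equalizer-projection
    ; equalizer-functor    = equalizer-functor
    ; equalizer-policy     = equalizer-policy
    ; power-projections    = λ pow x → power-projections pow (category x)
    ; power-functor        = λ {_} {_} {_} {π} pow x y → power-functor {π = π} pow (category x) (category y)
    ; power-policy         = λ {_} {_} {_} {π} pow x → power-policy {π = π} pow (category x)
    ; ♯-lifting            = λ l r r′ s h fib pb pb′ e c →
        let x = ♯-lifting l r r′ s h fib pb pb′ e c in first x , second x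
    ; ♯-lifting-op         = λ l r r′ s h fib pb pb′ e c →
        let x = ♯-lifting-op l r r′ s h fib pb pb′ e c in first x , second x
    }

  module _ (T : PreTheory ctx) (judgemental : IsJudgemental T) (S⊆T : S ⊆ T) where
    private
      module T = PreTheory T
      module J = IsJudgemental judgemental
      module I = _⊆_ S⊆T

      Holds : Item ℓ → Set (suc ℓ)
      Holds (isRule F)     = T.Rule F
      Holds (isPolicy α)   = T.Policy α
      Holds (isCategory 𝒳) = T.Category-of-theory 𝒳
      Holds (i and j)      = Holds i × Holds j

      -- A fold: `T` satisfies the closure condition behind each constructor. Classifier generators
      -- are read as rules, which `generatedTheory-least` undoes with `rule⇒classifier`.
      holds : ∀ {i} → Generated i → Holds i
      holds (first x)                = proj₁ (holds x)
      holds (second x)               = proj₂ (holds x)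
      holds (classifier-generator x) = J.classifier⇒rule (I.classifiers x)
      holds (rule-generator x)       = I.rules x
      holds (policy-generator x)     = I.policies x
      holds (rule-resp p x)          = T.rule-resp p (holds x)
      holds (policy-resp p x)        = T.policy-resp p (holds x)
      holds (domain x)               = T.dom (holds x)
      holds (codomain x)             = T.cod (holds x)
      holds (rule-∘ x y)             = J.rule-∘ (holds x) (holds y)
      holds (policy-• x y)           = J.policy-• (holds x) (holds y)
      holds (whiskerˡ r x)           = J.whiskerˡ (holds r) (holds x)
      holds (whiskerʳ x r)           = J.whiskerʳ (holds x) (holds r)
      holds (pullback-projections pb f g) = J.pullback-projections pb (holds f) (holds g)
      holds (pullback-functor pb f g x y) =
        J.pullback-functor pb (holds f) (holds g) (holds x) (holds y)
      holds (pullback-policy pb f g m n x y) =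
        J.pullback-policy pb (holds f) (holds g) (holds m) (holds n) (holds x) (holds y)
      holds (equalizer-projection eq f g) = J.equalizer-projection eq (holds f) (holds g)
      holds (equalizer-functor eq f g x) =
        J.equalizer-functor eq (holds f) (holds g) (holds x)
      holds (equalizer-policy eq f g m n x) =
        J.equalizer-policy eq (holds f) (holds g) (holds m) (holds n) (holds x)
      holds (power-projections pow x i) = J.power-projections pow (holds x) i
      holds (power-functor {π = π} pow x y m) =
        J.power-functor {π = π} pow (holds x) (holds y) (λ i → holds (m i))
      holds (power-policy {π = π} pow x m k y) =
        J.power-policy {π = π} pow (holds x) (holds m) (holds k) (λ i → holds (y i))
      holds (♯-lifting l r r′ s h fib pb pb′ e c) =
        J.♯-lifting (holds l) (holds r) (holds r′) (holds s) (holds h) fib pb pb′ e c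
      holds (♯-lifting-op l r r′ s h fib pb pb′ e c) =
        J.♯-lifting-op (holds l) (holds r) (holds r′) (holds s) (holds h) fib pb pb′ e c

    generatedTheory-least : generatedTheory ⊆ T
    generatedTheory-least = record
      { classifiers = λ x → J.rule⇒classifier (holds x)
      ; rules       = holds
      ; policies    = holds
      }

  generatedTheory-isGenerated : generatedTheory IsGeneratedBy S
  generatedTheory-isGenerated = record
    { judgemental = generatedTheory-judgemental
    ; contains    = record
        { classifiers = classifier-generator
        ; rules       = rule-generator
        ; policies    = policy-generator
        }
    ; least       = generatedTheory-least
    }

-- Arrows and adjunctions

module _ (𝒞 : Category ℓ) where
  open Category 𝒞

  -- This is axiom K: the equalities of endpoints contained in the hypothesis are loops, hence
  -- trivial.
  arrow-injective : ∀ {A B} {f g : A ⇒ B} → arrow 𝒞 f ≡ arrow 𝒞 g → f ≡ g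
  arrow-injective refl = refl

  arrow-∘ : ∀ {A B C A′ B′ C′} {g : B ⇒ C} {f : A ⇒ B} {g′ : B′ ⇒ C′} {f′ : A′ ⇒ B′} →
            arrow 𝒞 g ≡ arrow 𝒞 g′ → arrow 𝒞 f ≡ arrow 𝒞 f′ →
            arrow 𝒞 (g ∘ f) ≡ arrow 𝒞 (g′ ∘ f′)
  arrow-∘ refl refl = refl

  arrow-id : ∀ {A B} → A ≡ B → arrow 𝒞 (id {A}) ≡ arrow 𝒞 (id {B})
  arrow-id refl = refl

  -- Transport packaged with its arrow equation, so that no `subst` has to be computed afterwards.
  recast : ∀ {A B A′ B′} (f : A ⇒ B) → A ≡ A′ → B ≡ B′ →
           Σ[ f′ ∈ A′ ⇒ B′ ] arrow 𝒞 f′ ≡ arrow 𝒞 f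
  recast f refl refl = f , refl

module _ {𝒞 𝒟 : Category ℓ} {L : Functor 𝒞 𝒟} {R : Functor 𝒟 𝒞} (L⊣R : L ⊣ R) where
  private
    module 𝒞 = Category 𝒞
    module 𝒟 = Category 𝒟
    module L = Functor L
    module R = Functor R
  open _⊣_ L⊣R

  transpose : ∀ {A B} → 𝒟 [ L ₀ A , B ] → 𝒞 [ A , R ₀ B ]
  transpose {A} g = R ₁ g 𝒞.∘ at η A

  untranspose : ∀ {A B} → 𝒞 [ A , R ₀ B ] → 𝒟 [ L ₀ A , B ]
  untranspose {B = B} h = at ε B 𝒟.∘ L ₁ h

  transpose-untranspose : ∀ {A B} (h : 𝒞 [ A , R ₀ B ]) → transpose (untranspose h) ≡ h
  transpose-untranspose {A} {B} h =
    trans (cong (𝒞._∘ at η A) (R.F-∘ (at ε B) (L ₁ h)))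
   (trans (𝒞.assoc (R ₁ at ε B) (R ₁ (L ₁ h)) (at η A))
   (trans (cong (R ₁ at ε B 𝒞.∘_) (sym (NatTrans.natural η h)))
   (trans (sym (𝒞.assoc (R ₁ at ε B) (at η (R ₀ B)) h))
   (trans (cong (𝒞._∘ h) (zag B)) (𝒞.identityˡ h)))))

  untranspose-transpose : ∀ {A B} (g : 𝒟 [ L ₀ A , B ]) → untranspose (transpose g) ≡ g
  untranspose-transpose {A} {B} g =
    trans (cong (at ε B 𝒟.∘_) (L.F-∘ (R ₁ g) (at η A)))
   (trans (sym (𝒟.assoc (at ε B) (L ₁ (R ₁ g)) (L ₁ at η A)))
   (trans (cong (𝒟._∘ L ₁ at η A) (NatTrans.natural ε g))
   (trans (𝒟.assoc g (at ε (L ₀ A)) (L ₁ at η A))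
   (trans (cong (g 𝒟.∘_) (zig A)) (𝒟.identityʳ g)))))

  untranspose-injective : ∀ {A B} {h h′ : 𝒞 [ A , R ₀ B ]} →
                          untranspose h ≡ untranspose h′ → h ≡ h′
  untranspose-injective {h = h} {h′} e =
    trans (sym (transpose-untranspose h))
   (trans (cong transpose e) (transpose-untranspose h′))

  -- The composite k ∘ l is the untransposition of h up to strict equality of objects.

  arrow-untranspose-injective :
    ∀ {A A′ B C x y z} {h : 𝒞 [ A , C ]} {h′ : 𝒞 [ A′ , R ₀ B ]}
    {k : 𝒟 [ y , z ]} {l : 𝒟 [ x , y ]} →
    A ≡ A′ → C ≡ R ₀ B → arrow 𝒟 k ≡ arrow 𝒟 (at ε B) → arrow 𝒟 l ≡ arrow 𝒟 (L ₁ h) →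
    arrow 𝒟 (k 𝒟.∘ l) ≡ arrow 𝒟 (untranspose h′) → arrow 𝒞 h ≡ arrow 𝒞 h′
  arrow-untranspose-injective refl refl refl refl e =
    cong (λ h → _ , _ , h) (untranspose-injective (arrow-injective 𝒟 e))

-- Discrete fibrations and presheaves

module _ {ℰ ℬ : Category ℓ} (p : Functor ℰ ℬ) (discrete : IsDiscreteFibration p) where
  private
    module ℰ = Category ℰ
    module ℬ = Category ℬ
    module p = Functor p

  -- Both morphisms lift `p ₁ f′` with codomain `B`, so both equal the unique such lift.
  lift-unique : ∀ {A A′ B} {f : ℰ [ A , B ]} {f′ : ℰ [ A′ , B ]} →
                arrow ℬ (p ₁ f) ≡ arrow ℬ (p ₁ f′) → arrow ℰ f ≡ arrow ℰ f′
  lift-unique {B = B} {f′ = f′} e =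
    let _ , _ , unique = discrete B (p ₁ f′)
    in  cong (λ (X , g) → X , B , g) (trans (sym (unique e)) (unique refl))

  lift-unique′ : ∀ {A A′ B B′} {f : ℰ [ A , B ]} {f′ : ℰ [ A′ , B′ ]} → B ≡ B′ →
                 arrow ℬ (p ₁ f) ≡ arrow ℬ (p ₁ f′) → arrow ℰ f ≡ arrow ℰ f′
  lift-unique′ refl = lift-unique

  -- The agreement on objects supplies the common codomains that `lift-unique` asks for.
  functor-ext : ∀ {𝒜} {F G : Functor 𝒜 ℰ} → p ∘F F ≡ᶠ p ∘F G → (∀ A → F ₀ A ≡ G ₀ A) → F ≡ᶠ G
  functor-ext e e₀ = mk≡ᶠ λ {_} {B} f → lift-unique′ (e₀ B) (on-arrow e f)

  private
    Fibre₀ : ℬ.Obj → Set _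
    Fibre₀ Γ = Σ[ E ∈ ℰ.Obj ] p ₀ E ≡ Γ

  fibre-ext : ∀ {Γ} {x y : Fibre₀ Γ} → proj₁ x ≡ proj₁ y → x ≡ y
  fibre-ext {x = _ , refl} {_ , refl} refl = refl

  fibre-ext′ : ∀ {Γ Γ′} {x : Fibre₀ Γ} {y : Fibre₀ Γ′} → proj₁ x ≡ proj₁ y →
               _≡_ {A = Σ ℬ.Obj Fibre₀} (Γ , x) (Γ′ , y)
  fibre-ext′ {x = _ , refl} {_ , refl} refl = refl

  private
    reindex : ∀ {Γ Δ} → ℬ [ Δ , Γ ] → Fibre₀ Γ → Fibre₀ Δ
    reindex σ (E , refl) = let (E′ , _) , e , _ = discrete E σ in E′ , cong proj₁ e

  -- Together with `reindex-unique` this characterises the action: `reindex σ x` is `y` exactly when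
  -- some morphism from `y` to `x` lies over `σ`. Leaving `y` free gives the lift a prescribed
  -- domain.
  reindex-lift : ∀ {Γ Δ} {σ : ℬ [ Δ , Γ ]} {x : Fibre₀ Γ} {y : Fibre₀ Δ} → reindex σ x ≡ y →
                 Σ[ f ∈ ℰ [ proj₁ y , proj₁ x ] ] arrow ℬ (p ₁ f) ≡ arrow ℬ σ
  reindex-lift {σ = σ} {E , refl} refl = let (_ , f) , e , _ = discrete E σ in f , e

  reindex-unique : ∀ {Γ Δ} {σ : ℬ [ Δ , Γ ]} {x : Fibre₀ Γ} {y : Fibre₀ Δ}
                   (f : ℰ [ proj₁ y , proj₁ x ]) → arrow ℬ (p ₁ f) ≡ arrow ℬ σ → reindex σ x ≡ y
  reindex-unique {σ = σ} {E , refl} f e =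
    let _ , _ , unique = discrete E σ in fibre-ext (cong proj₁ (unique e))

  Fibre : Presheaf ℬ
  Fibre = record
    { F₀   = Fibre₀
    ; F₁   = reindex
    ; F-id = λ x → reindex-unique ℰ.id (trans (cong (arrow ℬ) p.F-id) (arrow-id ℬ (proj₂ x)))
    ; F-∘  = λ τ σ x →
        let g , eg = reindex-lift {σ = τ} {x} refl
            f , ef = reindex-lift {σ = σ} {reindex τ x} refl
        in  reindex-unique (g ℰ.∘ f) (trans (cong (arrow ℬ) (p.F-∘ g f)) (arrow-∘ ℬ eg ef))
    }

  fromFibre : Functor (∫ Fibre) ℰ
  fromFibre = record
    { F₀   = λ (_ , E , _) → E
    ; F₁   = λ {_} {(_ , x)} (_ , e) → proj₁ (reindex-lift {x = x} e)
    ; F-id = λ {(_ , x)} → arrow-injective ℰ (lift-unique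
        (trans (proj₂ (reindex-lift {x = x} (Presheaf.F-id Fibre x)))
        (sym (trans (cong (arrow ℬ) p.F-id) (arrow-id ℬ (proj₂ x))))))
    ; F-∘  = λ {_} {(_ , y)} {(_ , z)} (g , q) (f , r) → arrow-injective ℰ (lift-unique
        (trans (proj₂ (reindex-lift {x = z} (proj₂ (Category._∘_ (∫ Fibre) (g , q) (f , r)))))
        (sym (trans (cong (arrow ℬ) (p.F-∘ _ _))
             (arrow-∘ ℬ (proj₂ (reindex-lift {x = z} q)) (proj₂ (reindex-lift {x = y} r)))))))
    }

  fromFibre-over : p ∘F fromFibre ≡ᶠ ∫π Fibre
  fromFibre-over = mk≡ᶠ λ {_} {(_ , x)} (_ , e) → proj₂ (reindex-lift {x = x} e)

module _ {ℰ ℰ′ ℬ : Category ℓ} (p : Functor ℰ ℬ) (p′ : Functor ℰ′ ℬ)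
         (discrete : IsDiscreteFibration p) (discrete′ : IsDiscreteFibration p′) where

  -- Naturality holds because `F` carries the lift of `σ` to a morphism over `σ`, which is again the
  -- lift.
  fibreMap : (F : Functor ℰ ℰ′) → p′ ∘F F ≡ᶠ p →
             PresheafMap (Fibre p discrete) (Fibre p′ discrete′)
  fibreMap F over = record
    { map     = λ (E , e) → F ₀ E , trans (on-obj over E) e
    ; natural = λ σ x →
        let f , e = reindex-lift p discrete {x = x} refl
        in  sym (reindex-unique p′ discrete′ (F ₁ f) (trans (on-arrow over f) e))
    }

module _ {𝒞 : Category ℓ} (X : Presheaf 𝒞) where
  private
    module 𝒞 = Category 𝒞
    module X = Presheaf X

  ∫-hom-ext : ∀ {A B} {f g : ∫ X [ A , B ]} → proj₁ f ≡ proj₁ g → f ≡ g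
  ∫-hom-ext {f = _ , refl} {_ , refl} refl = refl

  ∫-discrete : IsDiscreteFibration (∫π X)
  ∫-discrete (Γ , x) {Δ} σ =
    ((Δ , X.F₁ σ x) , σ , refl) , refl , λ { {_ , _ , refl} refl → refl }

  ∫-cartesian : ∀ {A B} {f : ∫ X [ A , B ]} → IsCartesian (∫π X) f
  ∫-cartesian {f = f , r} (g , s) w e =
    -- The factorisation can only be `w`; it respects the elements because `f ∘ w` is `g`.
    (w , trans (cong (X.F₁ w) (sym r))
        (trans (sym (X.F-∘ f w _)) (trans (cong (λ k → X.F₁ k _) e) s))) ,
    (refl , ∫-hom-ext e) , λ (e′ , _) → ∫-hom-ext (sym e′)

  ∫-fibration : IsFibration (∫π X)
  ∫-fibration = record
    { reindex   = λ (_ , x) {I} σ → I , X.F₁ σ x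
    ; lift      = λ _ σ → σ , refl
    ; over      = λ _ _ → refl
    ; cartesian = λ _ _ → ∫-cartesian
    }

module _ {𝒜 𝒞 : Category ℓ} {X : Presheaf 𝒞} where

  ∫-functor-ext : {F G : Functor 𝒜 (∫ X)} →
    (∀ {A B} (f : 𝒜 [ A , B ]) → arrow 𝒞 (proj₁ (F ₁ f)) ≡ arrow 𝒞 (proj₁ (G ₁ f))) →
    (∀ A → F ₀ A ≡ G ₀ A) → F ≡ᶠ G
  ∫-functor-ext e = functor-ext (∫π X) (∫-discrete X) (mk≡ᶠ e)

module _ {ℰ ℬ : Category ℓ} (p : Functor ℰ ℬ) (discrete : IsDiscreteFibration p) where
  private
    module p = Functor p
    F = Fibre p discrete

  toFibre : Functor ℰ (∫ F)
  toFibre = record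
    { F₀   = λ E → p ₀ E , E , refl
    ; F₁   = λ f → p ₁ f , reindex-unique p discrete f refl
    ; F-id = ∫-hom-ext F p.F-id
    ; F-∘  = λ g f → ∫-hom-ext F (p.F-∘ g f)
    }

  from∘toFibre : fromFibre p discrete ∘F toFibre ≡ᶠ idF ℰ
  from∘toFibre = functor-ext p discrete
    (mk≡ᶠ λ f → proj₂ (reindex-lift p discrete {x = _ , refl} (proj₂ (toFibre ₁ f)))) (λ _ → refl)

  to∘fromFibre : toFibre ∘F fromFibre p discrete ≡ᶠ idF (∫ F)
  to∘fromFibre = ∫-functor-ext
    (on-arrow (fromFibre-over p discrete)) (λ _ → fibre-ext′ p discrete refl)

-- By the Yoneda lemma, the square of a context extension is a pullback as soon as it is
-- one on elements.

module _ {𝒞 : Category ℓ} {X Y : Presheaf 𝒞} (p : PresheafMap X Y)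
         {Γ Γ′ : Category.Obj 𝒞} (A : Presheaf.F₀ Y Γ) (δ : 𝒞 [ Γ′ , Γ ]) where
  open Category 𝒞
  private
    module X = Presheaf X
    module Y = Presheaf Y

  IsExtension : X.F₀ Γ′ → Set _
  IsExtension x = ∀ {Θ} (a : X.F₀ Θ) (f : Θ ⇒ Γ) → map p a ≡ Y.F₁ f A →
                  ∃! _≡_ λ (m : Θ ⇒ Γ′) → X.F₁ m x ≡ a × δ ∘ m ≡ f

  isExtension⇒isPullback : (x : X.F₀ Γ′) → map p x ≡ Y.F₁ δ A → IsExtension x →
    IsPullback (PSh 𝒞) (⌜_⌝ {X = X} x) (𝐲₁ δ) p (⌜_⌝ {X = Y} A)
  isExtension⇒isPullback x e extend = record
    { commute   = λ f → trans (PresheafMap.natural p f x)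
                       (trans (cong (Y.F₁ f) e) (sym (Y.F-∘ δ f A)))
    ; universal = λ {Q} a b e′ →
        let m : ∀ {Θ} → Presheaf.F₀ Q Θ → Θ ⇒ Γ′
            m z = proj₁ (extend (map a z) (map b z) (e′ z))
            mx : ∀ {Θ} (z : Presheaf.F₀ Q Θ) → X.F₁ (m z) x ≡ map a z
            mx z = proj₁ (proj₁ (proj₂ (extend (map a z) (map b z) (e′ z))))
            δm : ∀ {Θ} (z : Presheaf.F₀ Q Θ) → δ ∘ m z ≡ map b z
            δm z = proj₂ (proj₁ (proj₂ (extend (map a z) (map b z) (e′ z))))
            unique : ∀ {Θ} (z : Presheaf.F₀ Q Θ) {n : Θ ⇒ Γ′} →
                     X.F₁ n x ≡ map a z × δ ∘ n ≡ map b z → m z ≡ n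
            unique z = proj₂ (proj₂ (extend (map a z) (map b z) (e′ z)))
        in  record
              { map     = m
              -- The mediating map is chosen pointwise; uniqueness makes it natural, since `m z ∘ f`
              -- satisfies the equations that determine `m` at the restriction of `z` along `f`.
              ; natural = λ f z → unique (Presheaf.F₁ Q f z)
                  ( trans (X.F-∘ (m z) f x)
                   (trans (cong (X.F₁ f) (mx z)) (sym (PresheafMap.natural a f z)))
                  , trans (sym (assoc δ (m z) f))
                   (trans (cong (_∘ f) (δm z)) (sym (PresheafMap.natural b f z))) )
              }
          , (mx , δm) , λ (nx , δn) z → unique z (nx z , δn z)
    }

  module _ {q : PresheafMap (𝐲 Γ′) X}
           (pullback : IsPullback (PSh 𝒞) q (𝐲₁ δ) p (⌜_⌝ {X = Y} A)) where
    private
      module P = IsPullback pullback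

      restrict : ∀ {Θ} (m : Θ ⇒ Γ′) → X.F₁ m (map q id) ≡ map q m
      restrict m = trans (sym (PresheafMap.natural q m id)) (cong (map q) (identityˡ m))

    isPullback⇒commutes : map p (map q id) ≡ Y.F₁ δ A
    isPullback⇒commutes = trans (P.commute id) (cong (λ f → Y.F₁ f A) (identityʳ δ))

    isPullback⇒isExtension : IsExtension (map q id)
    isPullback⇒isExtension {Θ} a f e =
      -- The pullback is tested on the representable `𝐲 Θ`, and the mediating map is read off at
      -- `id`.
      let m , (qm , δm) , unique = P.universal (⌜_⌝ {X = X} a) (𝐲₁ f) λ g →
            trans (PresheafMap.natural p g a)
           (trans (cong (Y.F₁ g) e) (sym (Y.F-∘ f g A)))
      in  map m id ,
          ( trans (restrict (map m id)) (trans (qm id) (X.F-id a))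
          , trans (δm id) (identityʳ f) ) ,
          λ {n} (nx , δn) → trans
            (unique {𝐲₁ n}
              ( (λ g → trans (sym (restrict (n ∘ g)))
                      (trans (X.F-∘ n g _) (cong (X.F₁ g) nx)))
              , (λ g → trans (sym (assoc δ n g)) (cong (_∘ g) δn)) )
              id)
            (identityʳ n)

-- The type theory of a natural model

module _ {ctx : Category ℓ} (M : NaturalModel ctx) where
  open Category ctx
  open NaturalModel M
  private
    module U = Presheaf U
    module U̇ = Presheaf U̇

    p-generic : ∀ {Γ} (A : U.F₀ Γ) → map p (generic A) ≡ U.F₁ (δ A) A
    p-generic A = isPullback⇒commutes p A (δ A) {q A} (pullback A)

    extends : ∀ {Γ} (A : U.F₀ Γ) → IsExtension p A (δ A) (generic A)
    extends A = isPullback⇒isExtension p A (δ A) {q A} (pullback A)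

    module _ {Γ Δ} (A : U.F₀ Γ) (a : U̇.F₀ Δ) (f : Δ ⇒ Γ) (e : map p a ≡ U.F₁ f A) where

      extend : Δ ⇒ Γ ▹ A
      extend = proj₁ (extends A a f e)

      extend-generic : U̇.F₁ extend (generic A) ≡ a
      extend-generic = proj₁ (proj₁ (proj₂ (extends A a f e)))

      δ-extend : δ A ∘ extend ≡ f
      δ-extend = proj₂ (proj₁ (proj₂ (extends A a f e)))

      extend-unique : {m : Δ ⇒ Γ ▹ A} → U̇.F₁ m (generic A) ≡ a → δ A ∘ m ≡ f → extend ≡ m
      extend-unique e e′ = proj₂ (proj₂ (extends A a f _)) (e , e′)

    -- Both maps are the extension determined by the data of `n`, namely the restricted generic term
    -- and `δ A ∘ n`.
    ▹-ext : ∀ {Γ Δ} (A : U.F₀ Γ) {m n : Δ ⇒ Γ ▹ A} →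
            U̇.F₁ m (generic A) ≡ U̇.F₁ n (generic A) → δ A ∘ m ≡ δ A ∘ n → m ≡ n
    ▹-ext A {m} {n} e e′ =
      trans (sym (extend-unique A _ _ over e e′)) (extend-unique A _ _ over refl refl)
      where
      over : map p (U̇.F₁ n (generic A)) ≡ U.F₁ (δ A ∘ n) A
      over = trans (PresheafMap.natural p n (generic A))
            (trans (cong (U.F₁ n) (p-generic A)) (sym (U.F-∘ (δ A) n A)))

    -- The compatibility that lets `generic A` and `f ∘ δ A` induce a map between the extensions;
    -- that map is the action of the right adjoint on `f`.
    weaken : ∀ {Γ Γ′} {A : U.F₀ Γ} {A′ : U.F₀ Γ′} (f : Γ ⇒ Γ′) → U.F₁ f A′ ≡ A →
             map p (generic A) ≡ U.F₁ (f ∘ δ A) A′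
    weaken {A = A} {A′} f r =
      trans (p-generic A)
     (trans (cong (U.F₁ (δ A)) (sym r)) (sym (U.F-∘ f (δ A) A′)))

    -- Extending `id` by `a` gives the section of `δ (map p a)` that the term `a` names; this
    -- section is the unit at `a`.
    section-over : ∀ {Γ} (a : U̇.F₀ Γ) → map p a ≡ U.F₁ id (map p a)
    section-over a = sym (U.F-id (map p a))

  ▹-functor : Functor (∫ U) (∫ U̇)
  ▹-functor = record
    { F₀   = λ (Γ , A) → Γ ▹ A , generic A
    ; F₁   = λ {(_ , A)} {(_ , A′)} (f , r) →
        extend A′ (generic A) (f ∘ δ A) (weaken f r) ,
        extend-generic A′ (generic A) (f ∘ δ A) (weaken f r)
    ; F-id = λ {(_ , A)} → ∫-hom-ext U̇
        (extend-unique A (generic A) (id ∘ δ A) _ (U̇.F-id (generic A))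
          (trans (identityʳ (δ A)) (sym (identityˡ (δ A)))))
    ; F-∘  = λ {(_ , A)} {(_ , B)} {(_ , C)} (g , s) (f , r) →
        let m = extend B (generic A) (f ∘ δ A) (weaken f r)
            n = extend C (generic B) (g ∘ δ B) (weaken g s)
        in  ∫-hom-ext U̇ (extend-unique C (generic A) ((g ∘ f) ∘ δ A) _
              (trans (U̇.F-∘ n m (generic C))
              (trans (cong (U̇.F₁ m) (extend-generic C (generic B) (g ∘ δ B) (weaken g s)))
                     (extend-generic B (generic A) (f ∘ δ A) (weaken f r))))
              (trans (sym (assoc (δ C) n m))
              (trans (cong (_∘ m) (δ-extend C (generic B) (g ∘ δ B) (weaken g s)))
              (trans (assoc g (δ B) m)
              (trans (cong (g ∘_) (δ-extend B (generic A) (f ∘ δ A) (weaken f r)))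
                     (sym (assoc g f (δ A))))))))
    }

  -- Naturality of the counit and `zig` are instances of `δ-extend`. Naturality of the unit and
  -- `zag` compare maps into an extension, so `▹-ext` reduces them to the generic term and to `δ`.
  p⊣▹ : ∫₁ p ⊣ ▹-functor
  p⊣▹ = record
    { η = record
        { at      = λ (_ , a) →
            extend (map p a) a id (section-over a) ,
            extend-generic (map p a) a id (section-over a)
        ; natural = λ {(_ , a)} {(_ , a′)} (f , r) →
            let s  = extend (map p a) a id (section-over a)
                s′ = extend (map p a′) a′ id (section-over a′)
                w  = weaken f (proj₂ (∫₁ p ₁ (f , r)))
                m  = extend (map p a′) (generic (map p a)) (f ∘ δ (map p a)) w
            in  ∫-hom-ext U̇ (▹-ext (map p a′)
                  (trans (U̇.F-∘ s′ f _)
                  (trans (cong (U̇.F₁ f) (extend-generic (map p a′) a′ id (section-over a′)))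
                  (trans r
                  (sym (trans (U̇.F-∘ m s _)
                       (trans (cong (U̇.F₁ s) (extend-generic (map p a′) _ _ w))
                              (extend-generic (map p a) a id (section-over a))))))))
                  (trans (sym (assoc _ s′ f))
                  (trans (cong (_∘ f) (δ-extend (map p a′) a′ id (section-over a′)))
                  (trans (identityˡ f)
                  (sym (trans (sym (assoc _ m s))
                       (trans (cong (_∘ s) (δ-extend (map p a′) _ _ w))
                       (trans (assoc f _ s)
                       (trans (cong (f ∘_) (δ-extend (map p a) a id (section-over a)))
                              (identityʳ f))))))))))
        }
    ; ε = record
        { at      = λ (_ , A) → δ A , sym (p-generic A)
        ; natural = λ {(_ , A)} {(_ , A′)} (f , r) →
            ∫-hom-ext U (δ-extend A′ (generic A) (f ∘ δ A) (weaken f r))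
        }
    ; zig = λ (_ , a) → ∫-hom-ext U (δ-extend (map p a) a id (section-over a))
    ; zag = λ (_ , A) →
        -- `B` is `A` weakened to its own extension, `s` is the unit at the generic term (the
        -- diagonal), and `m` is the right adjoint applied to the counit at `A`.
        let B  = map p (generic A)
            s  = extend B (generic A) id (section-over (generic A))
            w  = weaken (δ A) (sym (p-generic A))
            m  = extend A (generic B) (δ A ∘ δ B) w
        in  ∫-hom-ext U̇ (▹-ext A
              (trans (U̇.F-∘ m s (generic A))
              (trans (cong (U̇.F₁ s) (extend-generic A (generic B) (δ A ∘ δ B) w))
              (trans (extend-generic B (generic A) id (section-over (generic A)))
                     (sym (U̇.F-id (generic A))))))
              (trans (sym (assoc (δ A) m s))
              (trans (cong (_∘ s) (δ-extend A (generic B) (δ A ∘ δ B) w))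
              (trans (assoc (δ A) (δ B) s)
                     (cong (δ A ∘_) (δ-extend B (generic A) id (section-over (generic A))))))))
    }

  presentationOf : Presentation ctx
  presentationOf .Presentation.𝒰           = ∫ U
  presentationOf .Presentation.𝒰̇           = ∫ U̇
  presentationOf .Presentation.u           = ∫π U
  presentationOf .Presentation.u̇           = ∫π U̇
  presentationOf .Presentation.Σᶠ          = ∫₁ p
  presentationOf .Presentation.Δᶠ          = ▹-functor
  presentationOf .Presentation.uΣ≡u̇        = mk≡ᶠ λ _ → refl
  presentationOf .Presentation.Σ⊣Δ         = p⊣▹
  presentationOf .Presentation.u-fibration = ∫-fibration U
  presentationOf .Presentation.u̇-fibration = ∫-fibration U̇
  presentationOf .Presentation.Σ-cartesian _ = ∫-cartesian U
  presentationOf .Presentation.Δ-cartesian _ = ∫-cartesian U̇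
  presentationOf .Presentation.η-cartesian _ = ∫-cartesian U̇
  presentationOf .Presentation.ε-cartesian _ = ∫-cartesian U

  theoryOf : DiscretePlainDTT ctx
  theoryOf .DiscretePlainDTT.plainDTT = record
    { presentation = presentationOf
    ; theory       = generatedTheory (generators presentationOf)
    ; generated    = generatedTheory-isGenerated (generators presentationOf)
    }
  theoryOf .DiscretePlainDTT.u-discrete = ∫-discrete U
  theoryOf .DiscretePlainDTT.u̇-discrete = ∫-discrete U̇

-- The natural model of a type theory

module _ {ctx : Category ℓ} (T : DiscretePlainDTT ctx) where
  open Category ctx
  open DiscretePlainDTT T
  private
    module 𝒰 = Category 𝒰
    module 𝒰̇ = Category 𝒰̇
    module U = Presheaf (Fibre u u-discrete)
    module U̇ = Presheaf (Fibre u̇ u̇-discrete)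
    module Σᶠ = Functor Σᶠ
    module u = Functor u

  typeFibre : Presheaf ctx
  typeFibre = Fibre u u-discrete

  termFibre : Presheaf ctx
  termFibre = Fibre u̇ u̇-discrete

  fibreTyping : PresheafMap termFibre typeFibre
  fibreTyping = fibreMap u̇ u u̇-discrete u-discrete Σᶠ uΣ≡u̇

  -- The context is taken to be u (Σ (Δ A)) rather than the equal u̇ (Δ A), so that
  -- u ε_A has it as its domain on the nose.

  extensionOf : ∀ {Γ} → U.F₀ Γ → Obj
  extensionOf (A , _) = u ₀ (Σᶠ ₀ (Δᶠ ₀ A))

  displayOf : ∀ {Γ} (A : U.F₀ Γ) → extensionOf A ⇒ Γ
  displayOf (A , refl) = u ₁ at ε A

  displayOf-ε : ∀ {Γ} (A : U.F₀ Γ) → arrow ctx (displayOf A) ≡ arrow ctx (u ₁ at ε (proj₁ A))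
  displayOf-ε (A , refl) = refl

  genericOf : ∀ {Γ} (A : U.F₀ Γ) → U̇.F₀ (extensionOf A)
  genericOf (A , _) = Δᶠ ₀ A , sym (on-obj uΣ≡u̇ (Δᶠ ₀ A))

  -- The counit at `A` lies over the display map, so its domain is the reindexing of `A`.
  typing-genericOf : ∀ {Γ} (A : U.F₀ Γ) → map fibreTyping (genericOf A) ≡ U.F₁ (displayOf A) A
  typing-genericOf A =
    sym (reindex-unique u u-discrete (at ε (proj₁ A)) (sym (displayOf-ε A)))

  -- The hypothesis on types says that `f` lifts to some `g` from `Σᶠ ₀ a` to `A`; the map into the
  -- extension is the image in `ctx` of the transpose of `g`.
  genericOf-isExtension : ∀ {Γ} (A : U.F₀ Γ) →
                          IsExtension fibreTyping A (displayOf A) (genericOf A)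
  genericOf-isExtension {Γ} (A , refl) {Θ} (a , e) f over =
    m , (mx , δm) , λ {n} (nx , δn) → unique n nx δn
    where
    lifted : Σ[ g ∈ 𝒰 [ Σᶠ ₀ a , A ] ] arrow ctx (u ₁ g) ≡ arrow ctx f
    lifted = reindex-lift u u-discrete (sym over)

    g = proj₁ lifted

    h : 𝒰̇ [ a , Δᶠ ₀ A ]
    h = transpose Σ⊣Δ g

    -- Only the domain needs recasting: it is `u ₀ (Σᶠ ₀ a)`, which equals `Θ` propositionally.
    recasted : Σ[ m ∈ Θ ⇒ u ₀ (Σᶠ ₀ (Δᶠ ₀ A)) ] arrow ctx m ≡ arrow ctx (u ₁ (Σᶠ ₁ h))
    recasted = recast ctx (u ₁ (Σᶠ ₁ h)) (trans (on-obj uΣ≡u̇ a) e) refl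

    m = proj₁ recasted

    composite : (k : 𝒰̇ [ a , Δᶠ ₀ A ]) (n : Θ ⇒ u ₀ (Σᶠ ₀ (Δᶠ ₀ A))) →
                arrow ctx n ≡ arrow ctx (u ₁ (Σᶠ ₁ k)) →
                arrow ctx (u ₁ at ε A ∘ n) ≡ arrow ctx (u ₁ untranspose Σ⊣Δ k)
    composite k n e = trans (arrow-∘ ctx refl e)
                            (cong (arrow ctx) (sym (u.F-∘ (at ε A) (Σᶠ ₁ k))))

    mx : U̇.F₁ m (genericOf (A , refl)) ≡ (a , e)
    mx = reindex-unique u̇ u̇-discrete h (trans (sym (on-arrow uΣ≡u̇ h)) (sym (proj₂ recasted)))

    δm : u ₁ at ε A ∘ m ≡ f
    δm = arrow-injective ctx
      (trans (composite h m (proj₂ recasted))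
      (trans (cong (λ k → arrow ctx (u ₁ k)) (untranspose-transpose Σ⊣Δ g)) (proj₂ lifted)))

    -- Any competitor `n` lifts to some `k` into `Δᶠ ₀ A`. Its untransposition has codomain `A` and
    -- lies over `f`, so it is `g`, and `k` is the transpose `h`.
    unique : (n : Θ ⇒ u ₀ (Σᶠ ₀ (Δᶠ ₀ A))) →
             U̇.F₁ n (genericOf (A , refl)) ≡ (a , e) → u ₁ at ε A ∘ n ≡ f → m ≡ n
    unique n nx δn = arrow-injective ctx
      (trans (proj₂ recasted)
      (trans (cong (λ h → arrow ctx (u ₁ (Σᶠ ₁ h))) h≡k) (sym n≡uΣk)))
      where
      k : 𝒰̇ [ a , Δᶠ ₀ A ]
      k = proj₁ (reindex-lift u̇ u̇-discrete {x = genericOf (A , refl)} nx)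

      n≡uΣk : arrow ctx n ≡ arrow ctx (u ₁ (Σᶠ ₁ k))
      n≡uΣk = sym (trans (on-arrow uΣ≡u̇ k)
                         (proj₂ (reindex-lift u̇ u̇-discrete {x = genericOf (A , refl)} nx)))

      untranspose≡g : untranspose Σ⊣Δ k ≡ g
      untranspose≡g = arrow-injective 𝒰 (lift-unique u u-discrete
        (trans (sym (composite k n n≡uΣk)) (trans (cong (arrow ctx) δn) (sym (proj₂ lifted)))))

      h≡k : h ≡ k
      h≡k = trans (cong (transpose Σ⊣Δ) (sym untranspose≡g)) (transpose-untranspose Σ⊣Δ k)

  modelOf : NaturalModel ctx
  modelOf .NaturalModel.U        = typeFibre
  modelOf .NaturalModel.U̇        = termFibre
  modelOf .NaturalModel.p        = fibreTyping
  modelOf .NaturalModel._▹_ _ A  = extensionOf A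
  modelOf .NaturalModel.δ        = displayOf
  modelOf .NaturalModel.q A      = ⌜_⌝ {X = termFibre} (genericOf A)
  modelOf .NaturalModel.pullback A =
    isExtension⇒isPullback fibreTyping A (displayOf A) (genericOf A)
      (typing-genericOf A) (genericOf-isExtension A)

  -- `generic` evaluates `q A` at `id`, so the chosen term comes back restricted along an identity.
  generic-modelOf : ∀ {Γ} (A : U.F₀ Γ) → NaturalModel.generic modelOf A ≡ genericOf A
  generic-modelOf A = U̇.F-id (genericOf A)

-- Morphisms of type theories and of natural models

-- In discrete fibrations a morphism is determined by its codomain and its image in ctx,
-- and ε determines Δ on morphisms and η; so only the action on objects and on the display
-- maps u ε need be compared.

module _ {ctx : Category ℓ} (S T : DiscretePlainDTT ctx) where
  private
    module S = DiscretePlainDTT S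
    module T = DiscretePlainDTT T

  module _ (ty : Functor S.𝒰 T.𝒰) (tm : Functor S.𝒰̇ T.𝒰̇)
           (over-u : T.u ∘F ty ≡ᶠ S.u) (over-u̇ : T.u̇ ∘F tm ≡ᶠ S.u̇)
           (Σ-obj : ∀ a → ty ₀ (S.Σᶠ ₀ a) ≡ T.Σᶠ ₀ (tm ₀ a))
           (Δ-obj : ∀ A → tm ₀ (S.Δᶠ ₀ A) ≡ T.Δᶠ ₀ (ty ₀ A))
           (display : ∀ A → arrow ctx (S.u ₁ at S.ε A) ≡ arrow ctx (T.u ₁ at T.ε (ty ₀ A))) where
    private
      module ty = Functor ty
      module 𝒰 = Category T.𝒰

      pres-Σ : ty ∘F S.Σᶠ ≡ᶠ T.Σᶠ ∘F tm
      pres-Σ = functor-ext T.u T.u-discrete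
        (mk≡ᶠ λ f → trans (on-arrow over-u (S.Σᶠ ₁ f))
                   (trans (on-arrow S.uΣ≡u̇ f)
                   (sym (trans (on-arrow T.uΣ≡u̇ (tm ₁ f)) (on-arrow over-u̇ f)))))
        Σ-obj

      pres-ε : ∀ A → arrow T.𝒰 (ty ₁ at S.ε A) ≡ arrow T.𝒰 (at T.ε (ty ₀ A))
      pres-ε A = lift-unique T.u T.u-discrete (trans (on-arrow over-u (at S.ε A)) (display A))

      -- After untransposition, naturality of the two counits turns both sides into `ty ₁ f`
      -- composed with the counit at `ty ₀ A`.
      pres-Δ : tm ∘F S.Δᶠ ≡ᶠ T.Δᶠ ∘F ty
      pres-Δ = mk≡ᶠ λ {A} {B} f → arrow-untranspose-injective T.Σ⊣Δ
        (Δ-obj A) (Δ-obj B) (pres-ε B) (on-arrow pres-Σ (S.Δᶠ ₁ f))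
        (trans (cong (arrow T.𝒰) (trans (sym (ty.F-∘ (at S.ε B) (S.Σᶠ ₁ (S.Δᶠ ₁ f))))
                                 (trans (cong (ty ₁_) (NatTrans.natural S.ε f))
                                        (ty.F-∘ f (at S.ε A)))))
        (trans (arrow-∘ T.𝒰 refl (pres-ε A))
               (cong (arrow T.𝒰) (sym (NatTrans.natural T.ε (ty ₁ f))))))

      -- By the triangle identities of `S` and `T`, both sides untranspose to an identity.
      pres-η : ∀ a → arrow T.𝒰̇ (tm ₁ at S.η a) ≡ arrow T.𝒰̇ (at T.η (tm ₀ a))
      pres-η a = arrow-untranspose-injective T.Σ⊣Δ
        refl (trans (Δ-obj (S.Σᶠ ₀ a)) (cong (T.Δᶠ ₀_) (Σ-obj a)))
        (trans (pres-ε (S.Σᶠ ₀ a)) (cong (λ A → arrow T.𝒰 (at T.ε A)) (Σ-obj a)))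
        (on-arrow pres-Σ (at S.η a))
        (trans (cong (arrow T.𝒰) (trans (sym (ty.F-∘ (at S.ε (S.Σᶠ ₀ a)) (S.Σᶠ ₁ at S.η a)))
                                 (trans (cong (ty ₁_) (_⊣_.zig S.Σ⊣Δ a)) ty.F-id)))
        (trans (arrow-id T.𝒰 (Σ-obj a))
               (cong (arrow T.𝒰) (sym (_⊣_.zig T.Σ⊣Δ (tm ₀ a))))))

    dttMap : DTTMap S T
    dttMap .DTTMap.ty     = ty
    dttMap .DTTMap.tm     = tm
    dttMap .DTTMap.over-u = over-u
    dttMap .DTTMap.over-u̇ = over-u̇
    dttMap .DTTMap.pres-Σ = pres-Σ
    dttMap .DTTMap.pres-Δ = pres-Δ
    dttMap .DTTMap.pres-η = pres-η
    dttMap .DTTMap.pres-ε = pres-ε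

module _ {ctx : Category ℓ} where

  theoryMap : {M N : NaturalModel ctx} → NMMap ctx M N → DTTMap (theoryOf M) (theoryOf N)
  theoryMap {M} {N} φ = dttMap (theoryOf M) (theoryOf N) (∫₁ ty) (∫₁ tm)
    (mk≡ᶠ λ _ → refl) (mk≡ᶠ λ _ → refl)
    (λ (Γ , a) → cong (Γ ,_) (sym (commute a))) (λ (_ , A) → pres-q A) (λ (_ , A) → pres-δ A)
    where open NMMap φ

  module _ {S T : DiscretePlainDTT ctx} (φ : DTTMap S T) where
    open DTTMap φ
    private
      module S = DiscretePlainDTT S
      module T = DiscretePlainDTT T

      tyMap : PresheafMap (typeFibre S) (typeFibre T)
      tyMap = fibreMap S.u T.u S.u-discrete T.u-discrete ty over-u

      tmMap : PresheafMap (termFibre S) (termFibre T)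
      tmMap = fibreMap S.u̇ T.u̇ S.u̇-discrete T.u̇-discrete tm over-u̇

    modelMap : NMMap ctx (modelOf S) (modelOf T)
    modelMap .NMMap.ty = tyMap
    modelMap .NMMap.tm = tmMap
    modelMap .NMMap.commute (a , _) = fibre-ext T.u T.u-discrete (sym (on-obj pres-Σ a))
    modelMap .NMMap.pres-δ A@(B , _) =
      trans (displayOf-ε S A)
     (trans (sym (on-arrow over-u (at S.ε B)))
     (trans (cong (Functor.onArrow T.u) (pres-ε B))
            (sym (displayOf-ε T (map tyMap A)))))
    modelMap .NMMap.pres-q A@(B , _) = fibre-ext′ T.u̇ T.u̇-discrete
      (trans (cong (λ (a , _) → tm ₀ a) (generic-modelOf S A))
      (trans (on-obj pres-Δ B)
             (sym (cong proj₁ (generic-modelOf T (map tyMap A))))))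

-- The equivalence

module _ (ctx : Category ℓ) where

  theoryFunctor : EFunctor (NaturalModels ctx) (DiscretePlainDTTs ctx)
  theoryFunctor = record
    { F₀       = theoryOf
    ; F₁       = theoryMap
    ; F-resp-≈ = λ (e , e′) → mk≈ᵀ
        (∫-functor-ext (λ _ → refl) λ (Γ , A) → cong (Γ ,_) (e A))
        (∫-functor-ext (λ _ → refl) λ (Γ , a) → cong (Γ ,_) (e′ a))
    ; F-id     = mk≈ᵀ
        (∫-functor-ext (λ _ → refl) λ _ → refl) (∫-functor-ext (λ _ → refl) λ _ → refl)
    ; F-∘      = λ _ _ → mk≈ᵀ
        (∫-functor-ext (λ _ → refl) λ _ → refl) (∫-functor-ext (λ _ → refl) λ _ → refl)
    }

  modelFunctor : EFunctor (DiscretePlainDTTs ctx) (NaturalModels ctx)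
  modelFunctor = record
    { F₀       = modelOf
    ; F₁       = modelMap
    ; F-resp-≈ = λ {_} {T} e →
        (λ (A , _) → fibre-ext (u T) (u-discrete T) (on-obj (≡ᶠ-ty e) A)) ,
        (λ (a , _) → fibre-ext (u̇ T) (u̇-discrete T) (on-obj (≡ᶠ-tm e) a))
    ; F-id     = λ {T} →
        (λ _ → fibre-ext (u T) (u-discrete T) refl) ,
        (λ _ → fibre-ext (u̇ T) (u̇-discrete T) refl)
    ; F-∘      = λ {_} {_} {T} _ _ →
        (λ _ → fibre-ext (u T) (u-discrete T) refl) ,
        (λ _ → fibre-ext (u̇ T) (u̇-discrete T) refl)
    }
    where open DiscretePlainDTT

  fibreOf∫ : (X : Presheaf ctx) → Iso (PSh ctx) X (Fibre (∫π X) (∫-discrete X))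
  fibreOf∫ X = record
    { to      = record
        { map     = λ x → (_ , x) , refl
        ; natural = λ _ _ → refl
        }
    ; from    = record
        { map     = λ { ((_ , x) , refl) → x }
        ; natural = λ { _ (_ , refl) → refl }
        }
    ; from∘to = λ _ → refl
    ; to∘from = λ { (_ , refl) → refl }
    }

  -- Extended contexts and display maps come back definitionally; the generic terms need
  -- `generic-modelOf`.
  modelUnit : ∀ M → Iso (NaturalModels ctx) M (modelOf (theoryOf M))
  modelUnit M = record
    { to      = record
        { ty      = Iso.to (fibreOf∫ U)
        ; tm      = Iso.to (fibreOf∫ U̇)
        ; commute = λ _ → refl
        ; pres-δ  = λ _ → refl
        ; pres-q  = λ A → cong (_ ,_) (sym (generic-modelOf (theoryOf M) (_ , refl)))
        }
    ; from    = record
        { ty      = Iso.from (fibreOf∫ U)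
        ; tm      = Iso.from (fibreOf∫ U̇)
        ; commute = λ { (_ , refl) → refl }
        ; pres-δ  = λ { (_ , refl) → refl }
        ; pres-q  = λ { (_ , refl) → cong (λ x → _ , map (Iso.from (fibreOf∫ U̇)) x)
                                         (generic-modelOf (theoryOf M) (_ , refl)) }
        }
    ; from∘to = Iso.from∘to (fibreOf∫ U) , Iso.from∘to (fibreOf∫ U̇)
    ; to∘from = Iso.to∘from (fibreOf∫ U) , Iso.to∘from (fibreOf∫ U̇)
    }
    where open NaturalModel M

  -- An element of the fibre presheaf is an object of the fibration with its context and a proof,
  -- both determined by the object; hence a strict isomorphism.
  theoryCounit : ∀ T → Iso (DiscretePlainDTTs ctx) (theoryOf (modelOf T)) T
  theoryCounit T = record
    { to      = dttMap (theoryOf (modelOf T)) T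
        (fromFibre u u-discrete) (fromFibre u̇ u̇-discrete)
        (fromFibre-over u u-discrete) (fromFibre-over u̇ u̇-discrete)
        (λ _ → refl) (λ (_ , A) → cong proj₁ (generic-modelOf T A))
        (λ (_ , A) → displayOf-ε T A)
    ; from    = dttMap T (theoryOf (modelOf T))
        (toFibre u u-discrete) (toFibre u̇ u̇-discrete)
        (mk≡ᶠ λ _ → refl) (mk≡ᶠ λ _ → refl)
        (λ a → fibre-ext′ u u-discrete refl)
        (λ A → fibre-ext′ u̇ u̇-discrete
                 (sym (cong proj₁ (generic-modelOf T (A , refl)))))
        (λ _ → refl)
    ; from∘to = mk≈ᵀ (to∘fromFibre u u-discrete) (to∘fromFibre u̇ u̇-discrete)
    ; to∘from = mk≈ᵀ (from∘toFibre u u-discrete) (from∘toFibre u̇ u̇-discrete)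
    }
    where open DiscretePlainDTT T

  -- Both composites agree on objects by computation and lie over `ctx`, so `functor-ext` applies.
  theoryCounit-natural : ∀ {S T} (φ : DTTMap S T) →
    (Iso.to (theoryCounit T) ∘ᵀ theoryMap (modelMap φ)) ≈ᵀ (φ ∘ᵀ Iso.to (theoryCounit S))
  theoryCounit-natural {S} {T} φ = mk≈ᵀ
    (functor-ext (u T) (u-discrete T) (mk≡ᶠ λ f →
      trans (on-arrow (fromFibre-over (u T) (u-discrete T)) (∫₁ (NMMap.ty (modelMap φ)) ₁ f))
     (sym (trans (on-arrow (over-u φ) (fromFibre (u S) (u-discrete S) ₁ f))
                 (on-arrow (fromFibre-over (u S) (u-discrete S)) f))))
      λ _ → refl)
    (functor-ext (u̇ T) (u̇-discrete T) (mk≡ᶠ λ f →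
      trans (on-arrow (fromFibre-over (u̇ T) (u̇-discrete T)) (∫₁ (NMMap.tm (modelMap φ)) ₁ f))
     (sym (trans (on-arrow (over-u̇ φ) (fromFibre (u̇ S) (u̇-discrete S) ₁ f))
                 (on-arrow (fromFibre-over (u̇ S) (u̇-discrete S)) f))))
      λ _ → refl)
    where
    open DiscretePlainDTT
    open DTTMap

  equivalence : Equivalence (NaturalModels ctx) (DiscretePlainDTTs ctx)
  equivalence = record
    { to             = theoryFunctor
    ; from           = modelFunctor
    ; unit           = modelUnit
    ; unit-natural   = λ _ → (λ _ → refl) , (λ _ → refl)
    ; counit         = theoryCounit
    ; counit-natural = theoryCounit-natural
    }

  -- A bare equivalence would not say which theory a model is sent to; this fixes it. The equations
  -- compute because `theoryOf` is built from `∫`.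
  theoryFunctor-realises : RealisesNaturally theoryFunctor
  theoryFunctor-realises = record
    { realises      = λ M → record
        { types  = identityIso
        ; terms  = identityIso
        ; over-u = mk≡ᶠ λ _ → refl
        ; over-u̇ = mk≡ᶠ λ _ → refl
        ; Σ-is-p = mk≡ᶠ λ _ → refl
        ; Δ-is-q = λ _ → refl
        ; ε-is-δ = λ _ → refl
        }
    ; natural-types = λ _ → mk≡ᶠ λ _ → refl
    ; natural-terms = λ _ → mk≡ᶠ λ _ → refl
    }
    where
    identityIso : ∀ {𝒜} → Iso (Cat ℓ) 𝒜 𝒜
    identityIso = record
      { to = idF _ ; from = idF _ ; from∘to = mk≡ᶠ λ _ → refl ; to∘from = mk≡ᶠ λ _ → refl }

theorem3p1p2 : ∀ {ℓ : Level} (ctx : Category ℓ) → Terminal ctx → Σ[ E ∈ Equivalence (NaturalModels ctx) (DiscretePlainDTTs ctx) ] RealisesNaturally (Equivalence.to E)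
theorem3p1p2 ctx _ = equivalence ctx , theoryFunctor-realises ctx
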